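{- Fix a real number $q$ with $0<q<\frac12$. For each integer $n\ge 1$, consider the two-phase game with parameters $(q,n)$ described in the context, and let $V_n(q)$ be the conditional variance of the duration of Phase II given that team B wins. Then, as $n\to\infty$, $$V_n(q)\to\frac{(1-q)(2+3q-4q^2)}{(1-2q)^4}.$$ More precisely, as $n\to\infty$, $$V_n(q)=\frac{(q-1)(4q^2-3q-2)}{(2q-1)^4}-\frac{(q-1)(4q^2+2q-7)}{(2q-1)^6}\cdot\frac1n-\frac{(q-1)(24q^4-12q^3-58q^2+29q+18)}{(2q-1)^8}\cdot\frac1{n^2}$$ $$-\frac{(q-1)(144q^6-216q^5-348q^4+444q^3+328q^2-312q-41)}{(2q-1)^{10}}\cdot\frac1{n^3}$$ $$-\frac{(q-1)(864q^8-2160q^7-1704q^6+4956q^5+4632q^4-9972q^3+1586q^2+1711q+88)}{(2q-1)^{12}}\cdot\frac1{n^4}+O\!\left(\frac1{n^5}\right).$$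
   Context: The two-phase game with parameters $q\in(0,\frac12)$ and positive integer $n$: two teams, G and B, play; each successive goal is scored by B with probability $q$ and by G with probability $1-q$, independently of all other goals. Phase I: play until G has scored $n$ goals; let $m$ be the number of goals B has scored by then. Phase II: if $m\ge n$, team B is declared the winner immediately (Phase II has duration $0$). If $m<n$, they keep playing until B has caught up and tied the score, in which case B is declared the winner; if B never ties the score, B loses. The duration of Phase II is the number of goals scored (by either team) during Phase II. The conditional variance given that B wins is the variance of this duration under the conditional probability measure given the event that B wins. The implied constant in $O(\cdot)$ may depend on the fixed $q$. -}

module Defs where

open import Level using (_⊔_) renaming (suc to lsuc)
open import Algebra.Apartness.Bundles using (HeytingField; HeytingCommutativeRing)
open import Algebra.Bundles using (CommutativeRing; Semiring)
open import Data.Bool.Base using (if_then_else_)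
open import Data.List.Base using (List; []; _∷_)
open import Data.Maybe.Base as Maybe using (Maybe; just; nothing; maybe′)
open import Data.Nat.Base as ℕ using (ℕ; zero; suc; NonZero; _≤ᵇ_)
open import Data.Product.Base using (Σ-syntax; ∃-syntax; _×_; _,_; proj₁; proj₂)
open import Data.Sum.Base using (_⊎_; inj₁; inj₂)
open import Function.Base using (const; _∘_)
open import Relation.Binary.Core using (Rel)
open import Relation.Binary.Structures using (IsStrictPartialOrder)
open import Relation.Nullary.Negation using (¬_; contradiction)

import Algebra.Apartness.Properties.HeytingCommutativeRing as HeytingProperties
import Algebra.Definitions.RawSemiring as RawSemiringDefinitions
import Algebra.Properties.Ring as RingProperties
import Relation.Binary.Reasoning.Setoid as SetoidReasoning

-- An ordered field in the constructive sense: x # y plays the role of x ≉ y.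
record OrderedField c ℓ₁ ℓ₂ : Set (lsuc (c ⊔ ℓ₁ ⊔ ℓ₂)) where

  infix 4 _<_ _≤_ ∣_∣<_ ∣_∣≤_ _⟶_

  field
    heytingField : HeytingField c ℓ₁ ℓ₂

  open HeytingField heytingField public

  commutativeRing : CommutativeRing c ℓ₁
  commutativeRing = HeytingCommutativeRing.commutativeRing heytingCommutativeRing

  -- n · x is the n-fold sum of x.
  open RawSemiringDefinitions (Semiring.rawSemiring (CommutativeRing.semiring commutativeRing)) public
    using (_^_) renaming (_×_ to _·_)

  field
    _<_                    : Rel Carrier ℓ₂
    <-isStrictPartialOrder : IsStrictPartialOrder _≈_ _<_
    #⇒<⊎>                  : ∀ {x y} → x # y → x < y ⊎ y < x
    <⇒#                    : ∀ {x y} → x < y → x # y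
    +-monoˡ-<              : ∀ z {x y} → x < y → x + z < y + z
    *-pos                  : ∀ {x y} → 0# < x → 0# < y → 0# < x * y

  _≤_ : Rel Carrier ℓ₂
  x ≤ y = ¬ (y < x)

  -- Stated without ∣_∣ itself, which on an ordered field would need a case distinction.
  ∣_∣<_ ∣_∣≤_ : Rel Carrier ℓ₂
  ∣ x ∣< ε = - ε < x × x < ε
  ∣ x ∣≤ b = - b ≤ x × x ≤ b

  _⟶_ : (ℕ → Carrier) → Carrier → Set (c ⊔ ℓ₂)
  a ⟶ l = ∀ ε → 0# < ε → ∃[ N ] ∀ n → N ℕ.≤ n → ∣ a n - l ∣< ε

  Cauchy : (ℕ → Carrier) → Set (c ⊔ ℓ₂)
  Cauchy a = ∀ ε → 0# < ε → ∃[ N ] ∀ m n → N ℕ.≤ m → N ℕ.≤ n → ∣ a m - a n ∣< ε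

-- The real numbers, axiomatised as a Cauchy-complete Archimedean ordered field.
-- Classically these axioms determine ℝ up to unique isomorphism.
record Reals c ℓ₁ ℓ₂ : Set (lsuc (c ⊔ ℓ₁ ⊔ ℓ₂)) where

  field
    orderedField : OrderedField c ℓ₁ ℓ₂

  open OrderedField orderedField public

  field
    archimedean : ∀ x → ∃[ n ] x < n · 1#
    complete    : ∀ a → Cauchy a → ∃[ l ] a ⟶ l

module RealArithmetic {c ℓ₁ ℓ₂} (ℝ : Reals c ℓ₁ ℓ₂) where

  open Reals ℝ public
  open IsStrictPartialOrder <-isStrictPartialOrder public using (<-respʳ-≈; <-respˡ-≈)
    renaming (irrefl to <-irrefl; trans to <-trans)
  open HeytingProperties heytingCommutativeRing public
    using (1#0; x#0y#0→xy#0; #-congʳ; x-0≈x)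
  open RingProperties (CommutativeRing.ring commutativeRing)
    using (-1*x≈-x; -‿involutive)
  open SetoidReasoning (CommutativeRing.setoid commutativeRing)

  infixl 7 _/_[_]
  infix  9 1/_

  -- `#⇒invertible y#0` inverts y - 0#, which is ≈ y.
  _/_[_] : ∀ x y → y # 0# → Carrier
  x / y [ y#0 ] = x * proj₁ (#⇒invertible y#0)

  ^-#0 : ∀ {x} → x # 0# → ∀ k → x ^ k # 0#
  ^-#0 x#0 zero    = 1#0
  ^-#0 x#0 (suc k) = x#0y#0→xy#0 x#0 (^-#0 x#0 k)

  x<y⇒0<y-x : ∀ {x y} → x < y → 0# < y - x
  x<y⇒0<y-x {x} x<y = <-respˡ-≈ (-‿inverseʳ x) (+-monoˡ-< (- x) x<y)

  x<y⇒x-y<0 : ∀ {x y} → x < y → x - y < 0#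
  x<y⇒x-y<0 {y = y} x<y = <-respʳ-≈ (-‿inverseʳ y) (+-monoˡ-< (- y) x<y)

  +-mono-< : ∀ {x y u v} → x < y → u < v → x + u < y + v
  +-mono-< {x} {y} {u} {v} x<y u<v = <-trans (+-monoˡ-< u x<y)
    (<-respˡ-≈ (+-comm u y) (<-respʳ-≈ (+-comm v y) (+-monoˡ-< y u<v)))

  0<1 : 0# < 1#
  0<1 with #⇒<⊎> 1#0
  ... | inj₂ 0<1 = 0<1
  ... | inj₁ 1<0 = <-respʳ-≈ [-1]²≈1 (*-pos 0<-1 0<-1)
    where
    0<-1 : 0# < - 1#
    0<-1 = <-respʳ-≈ (+-identityˡ (- 1#)) (x<y⇒0<y-x 1<0)
    [-1]²≈1 : - 1# * - 1# ≈ 1#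
    [-1]²≈1 = trans (-1*x≈-x (- 1#)) (-‿involutive 1#)

  0<suc·1 : ∀ n → 0# < suc n · 1#
  0<suc·1 zero    = <-respʳ-≈ (sym (+-identityʳ 1#)) 0<1
  0<suc·1 (suc n) = <-respˡ-≈ (+-identityˡ 0#) (+-mono-< 0<1 (0<suc·1 n))

  n·1#0 : ∀ n .{{_ : NonZero n}} → n · 1# # 0#
  n·1#0 (suc n) = #-sym (<⇒# (0<suc·1 n))

  1/_ : ∀ n .{{_ : NonZero n}} → Carrier
  1/ n = 1# / n · 1# [ n·1#0 n ]

  ½ : Carrier
  ½ = 1/ 2

  ½+½≈1 : ½ + ½ ≈ 1#
  ½+½≈1 = begin
    ½ + ½                   ≈⟨ +-cong (*-identityˡ h) (*-identityˡ h) ⟩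
    h + h                   ≈⟨ +-cong (*-identityˡ h) (*-identityˡ h) ⟨
    1# * h + 1# * h         ≈⟨ distribʳ h 1# 1# ⟨
    (1# + 1#) * h           ≈⟨ *-congʳ (+-congˡ (+-identityʳ 1#)) ⟨
    2 · 1# * h              ≈⟨ *-congʳ (x-0≈x (2 · 1#)) ⟨
    (2 · 1# - 0#) * h       ≈⟨ proj₂ (proj₂ 2-invertible) ⟩
    1#                      ∎
    where
    2-invertible = #⇒invertible (n·1#0 2)
    h = proj₁ 2-invertible

  x<½⇒2x<1 : ∀ {x} → x < ½ → 2 · x < 1#
  x<½⇒2x<1 {x} x<½ = <-respˡ-≈ (+-congˡ (sym (+-identityʳ x)))
    (<-respʳ-≈ ½+½≈1 (+-mono-< x<½ x<½))

  1-2x#0 : ∀ {x} → x < ½ → 1# - 2 · x # 0#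
  1-2x#0 x<½ = #-sym (<⇒# (x<y⇒0<y-x (x<½⇒2x<1 x<½)))

  2x-1#0 : ∀ {x} → x < ½ → 2 · x - 1# # 0#
  2x-1#0 x<½ = <⇒# (x<y⇒x-y<0 (x<½⇒2x<1 x<½))

data Team : Set where
  G B : Team

-- A play is the list of the scorers, in order.  `duration n w` is `just d` when the game
-- with parameter n is won by B exactly at the end of w, after a Phase II of d goals; it is
-- `nothing` when after w the game is not yet over, or was already over before the end of w.

-- g and b are the current scores.  The case b ≥ g at the start of Phase II is B's immediate
-- win; later on, as goals come one at a time, b ≥ g first happens at a tie.
phaseII : (g b : ℕ) → List Team → Maybe ℕ
phaseII g b []      = if g ≤ᵇ b then just 0 else nothing
phaseII g b (G ∷ w) = if g ≤ᵇ b then nothing else Maybe.map suc (phaseII (suc g) b w)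
phaseII g b (B ∷ w) = if g ≤ᵇ b then nothing else Maybe.map suc (phaseII g (suc b) w)

-- r is the number of goals G still has to score in Phase I.
phaseI : (r g b : ℕ) → List Team → Maybe ℕ
phaseI zero    g b w       = phaseII g b w
phaseI (suc r) g b []      = nothing
phaseI (suc r) g b (G ∷ w) = phaseI r (suc g) b w
phaseI (suc r) g b (B ∷ w) = phaseI (suc r) g (suc b) w

duration : ℕ → List Team → Maybe ℕ
duration n = phaseI n 0 0

module TwoPhaseGame {c ℓ₁ ℓ₂} (ℝ : Reals c ℓ₁ ℓ₂) where

  open RealArithmetic ℝ public

  module _ (q : Carrier) where

    goalProbability : Team → Carrier
    goalProbability B = q
    goalProbability G = 1# - q

    -- The probability that the sequence of goals starts with w.
    probability : List Team → Carrier
    probability []      = 1#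
    probability (t ∷ w) = goalProbability t * probability w

    ∑words : ℕ → (List Team → Carrier) → Carrier
    ∑words zero    f = f []
    ∑words (suc k) f = ∑words k (f ∘ (G ∷_)) + ∑words k (f ∘ (B ∷_))

    ∑< : ℕ → (ℕ → Carrier) → Carrier
    ∑< zero    a = 0#
    ∑< (suc k) a = ∑< k a + a k

    -- "B wins" is the disjoint union, over the plays w that B wins exactly at the end of w,
    -- of the events "the sequence of goals starts with w".  `Integral n f s` says that
    -- E[f(D); B wins] = s, where D is the duration of Phase II: the series over all such w,
    -- grouped by length, converges to s.
    Integral : ℕ → (ℕ → Carrier) → Carrier → Set (c ⊔ ℓ₂)
    Integral n f s =
      (λ K → ∑< K λ k → ∑words k λ w → probability w * maybe′ f 0# (duration n w)) ⟶ s

    -- E[f(D) | B wins] = e, with P(B wins) = p apart from 0.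
    IsConditionalExpectation : ℕ → (ℕ → Carrier) → Carrier → Set (c ⊔ ℓ₁ ⊔ ℓ₂)
    IsConditionalExpectation n f e =
      ∃[ p ] ∃[ s ] Σ[ p#0 ∈ p # 0# ]
        Integral n (const 1#) p × Integral n f s × e ≈ s / p [ p#0 ]

    IsConditionalVariance : ℕ → Carrier → Set (c ⊔ ℓ₁ ⊔ ℓ₂)
    IsConditionalVariance n v =
      ∃[ μ ] IsConditionalExpectation n (λ d → d · 1#) μ
           × IsConditionalExpectation n (λ d → (d · 1# - μ) ^ 2) v

  module _ (q : Carrier) (q<½ : q < ½) where

    limitVariance : Carrier
    limitVariance =
      (1# - q) * (2 · 1# + 3 · q - 4 · q ^ 2) / (1# - 2 · q) ^ 4 [ ^-#0 (1-2x#0 q<½) 4 ]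

    over[2q-1]^ : ℕ → Carrier → Carrier
    over[2q-1]^ k x = x / (2 · q - 1#) ^ k [ ^-#0 (2x-1#0 q<½) k ]

    expansion : ∀ n .{{_ : NonZero n}} → Carrier
    expansion n =
        over[2q-1]^ 4 ((q - 1#) * (4 · q ^ 2 - 3 · q - 2 · 1#))
      - over[2q-1]^ 6 ((q - 1#) * (4 · q ^ 2 + 2 · q - 7 · 1#)) * 1/ n
      - over[2q-1]^ 8 ((q - 1#) *
          (24 · q ^ 4 - 12 · q ^ 3 - 58 · q ^ 2 + 29 · q + 18 · 1#)) * 1/ n ^ 2
      - over[2q-1]^ 10 ((q - 1#) *
          (144 · q ^ 6 - 216 · q ^ 5 - 348 · q ^ 4 + 444 · q ^ 3 + 328 · q ^ 2
            - 312 · q - 41 · 1#)) * 1/ n ^ 3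
      - over[2q-1]^ 12 ((q - 1#) *
          (864 · q ^ 8 - 2160 · q ^ 7 - 1704 · q ^ 6 + 4956 · q ^ 5 + 4632 · q ^ 4
            - 9972 · q ^ 3 + 1586 · q ^ 2 + 1711 · q + 88 · 1#)) * 1/ n ^ 4

{-# OPTIONS --safe #-}
module Submission where

-- Write p = 1 - q and δ = 1 - 2q.  Solving the random walk of Phase II gives the first two moments of its
-- duration in terms of the gap at its start, and summing over Phase I gives
-- P(B wins) = 2T, E[D; B wins] = n (a - δT) / (δq), and a similar formula for the second moment.  Here T is
-- the probability that B is the first to score n goals, and a = C(2n - 1 , n) pⁿqⁿ.  So the variance is an
-- explicit function of n and g = δT / a.  From T_n - T_{n+1} = δ a_n and (n + 1) a_{n+1} = 2 (2n + 1) pq a_n,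
-- g satisfies a first-order recurrence which contracts by the factor 4pq < 1.  Hence the truncated formal
-- power series solution Φ in 1/n approximates g to the order of its defect, and the expansion of the variance
-- reduces to the vanishing of the low coefficients of two integer polynomials, which is checked by computation.

open import Defs
open import Algebra.Bundles using (CommutativeRing; RawRing)
open import Algebra.Solver.Ring.AlmostCommutativeRing
  using (_-Raw-AlmostCommutative⟶_; fromCommutativeRing)
open import Data.Bool.Base as Bool using (Bool; true; false; _∧_)
open import Data.Fin.Base using (zero; suc)
open import Data.Integer.Base as ℤ using (ℤ; +_; -[1+_]; +[1+_]) renaming (-_ to −_)
open import Data.List.Base using (List; []; _∷_; length)
open import Data.Maybe.Base as Maybe using (Maybe; just; nothing; maybe′; is-just)
open import Data.Nat.Base as ℕ using (ℕ; zero; suc; NonZero; _≤ᵇ_)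
open import Data.Product.Base using (∃-syntax; _×_; _,_; proj₁; proj₂)
open import Data.Sum.Base using (_⊎_; inj₁; inj₂; [_,_]′)
open import Data.Unit.Base using (tt)
open import Data.Vec.Base as Vec using (Vec; []; _∷_)
open import Data.Vec.N-ary using (N-ary; Eq; curryⁿ; curryⁿ-cong; _$ⁿ_)
open import Data.Vec.Relation.Unary.All using (All; []; _∷_)
open import Function.Base using (_∘_)
open import Level using (_⊔_)
open import Relation.Binary.PropositionalEquality.Core as ≡ using (_≡_)
open import Relation.Nullary.Decidable.Core using (yes; no)
open import Relation.Nullary.Negation using (contradiction)

import Algebra.Apartness.Properties.HeytingCommutativeRing as HeytingProperties
import Algebra.Properties.Semiring.Exp as SemiringExp
import Algebra.Properties.Semiring.Mult as SemiringMult
import Data.Integer.Properties as ℤ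
import Data.Nat.Properties as ℕ
import Relation.Binary.Reasoning.Setoid as SetoidReasoning

-- The closed forms rest on one exchange. From a gap i, B catches up with probability (q / p)ⁱ, and
-- weighting the paths of Phase I by this factor swaps p and q. Started from equal scores, winning
-- through Phase II is therefore exactly as likely as winning in Phase I, whence 2T, and the moments
-- of D become moments of a negative binomial variable cut off at n. An expectation is here the
-- limit of a series over plays, cut off by length, and the order is not decidable. So each closed
-- form is verified against its first-step recursion, with an explicit geometric rate in the cutoff
-- where infinitely many steps are involved. In the equation for the variance v, the unknown v
-- carries a factor 1/n², so two orders are lost: an error O(1/n⁵) requires g up to O(1/n⁷), that
-- is, Φ up to the sixth power of 1/n. In the variable 1/(δ²n) all coefficients are integer
-- polynomials in q, which makes the verification by computation possible.

-- A ring solver with integer coefficients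

module IntegerRingSolver {c ℓ} (R : CommutativeRing c ℓ) where

  open CommutativeRing R
  open import Algebra.Properties.Ring ring
  open import Algebra.Properties.AbelianGroup +-abelianGroup using (⁻¹-∙-comm)
  open import Algebra.Properties.Semiring.Mult.TCOptimised semiring renaming (_×_ to _⊗_)
  import Algebra.Properties.Semiring.Mult semiring as U
  open import Relation.Binary.Reasoning.Setoid setoid

  private
    -- With this optimised multiple, `con (+ 1)` and `con (+ 2)` evaluate definitionally to `1#` and
    -- `1# + 1#`, the forms in which the proofs write these constants.
    fromℤ : ℤ → Carrier
    fromℤ (+ n)      = n ⊗ 1#
    fromℤ (-[1+ n ]) = - (suc n ⊗ 1#)

    suc-× : ∀ n → suc n ⊗ 1# ≈ 1# + n ⊗ 1#
    suc-× n = ×-homo-+ 1# 1 n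

    cancel-1 : ∀ x y → x - y ≈ (1# + x) - (1# + y)
    cancel-1 x y = begin
      x - y                    ≈⟨ +-congʳ (+-identityˡ x) ⟨
      0# + x - y               ≈⟨ +-congʳ (+-congʳ (-‿inverseʳ 1#)) ⟨
      1# - 1# + x - y          ≈⟨ +-congʳ (+-assoc 1# (- 1#) x) ⟩
      1# + (- 1# + x) - y      ≈⟨ +-congʳ (+-congˡ (+-comm (- 1#) x)) ⟩
      1# + (x - 1#) - y        ≈⟨ +-congʳ (+-assoc 1# x (- 1#)) ⟨
      1# + x - 1# - y          ≈⟨ +-assoc (1# + x) (- 1#) (- y) ⟩
      1# + x + (- 1# - y)      ≈⟨ +-congˡ (⁻¹-∙-comm 1# y) ⟩
      1# + x - (1# + y)        ∎

    fromℤ-⊖ : ∀ m n → fromℤ (m ℤ.⊖ n) ≈ m ⊗ 1# - n ⊗ 1#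
    fromℤ-⊖ m       zero    = sym (trans (+-congˡ -0#≈0#) (+-identityʳ _))
    fromℤ-⊖ zero    (suc n) = sym (+-identityˡ _)
    fromℤ-⊖ (suc m) (suc n) = begin
      fromℤ (suc m ℤ.⊖ suc n)          ≡⟨ ≡.cong fromℤ (ℤ.[1+m]⊖[1+n]≡m⊖n m n) ⟩
      fromℤ (m ℤ.⊖ n)                  ≈⟨ fromℤ-⊖ m n ⟩
      m ⊗ 1# - n ⊗ 1#                  ≈⟨ cancel-1 _ _ ⟩
      1# + m ⊗ 1# - (1# + n ⊗ 1#)      ≈⟨ +-cong (suc-× m) (-‿cong (suc-× n)) ⟨
      suc m ⊗ 1# - suc n ⊗ 1#          ∎

    fromℤ-neg : ∀ i → fromℤ (ℤ.- i) ≈ - fromℤ i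
    fromℤ-neg (+ zero)  = sym -0#≈0#
    fromℤ-neg +[1+ n ]  = refl
    fromℤ-neg -[1+ n ]  = sym (-‿involutive _)

    fromℤ-+ : ∀ i j → fromℤ (i ℤ.+ j) ≈ fromℤ i + fromℤ j
    fromℤ-+ (+ m)    (+ n)    = ×-homo-+ 1# m n
    fromℤ-+ (+ m)    -[1+ n ] = fromℤ-⊖ m (suc n)
    fromℤ-+ -[1+ m ] (+ n)    = trans (fromℤ-⊖ n (suc m)) (+-comm _ _)
    fromℤ-+ -[1+ m ] -[1+ n ] = begin
      - (suc (suc (m ℕ.+ n)) ⊗ 1#)        ≈⟨ -‿cong (suc-× (suc (m ℕ.+ n))) ⟩
      - (1# + suc (m ℕ.+ n) ⊗ 1#)         ≈⟨ -‿cong (+-congˡ (×-homo-+ 1# (suc m) n)) ⟩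
      - (1# + (suc m ⊗ 1# + n ⊗ 1#))      ≈⟨ -‿cong (+-assoc _ _ _) ⟨
      - (1# + suc m ⊗ 1# + n ⊗ 1#)        ≈⟨ -‿cong (+-congʳ (+-comm _ _)) ⟩
      - (suc m ⊗ 1# + 1# + n ⊗ 1#)        ≈⟨ -‿cong (+-assoc _ _ _) ⟩
      - (suc m ⊗ 1# + (1# + n ⊗ 1#))      ≈⟨ -‿cong (+-congˡ (suc-× n)) ⟨
      - (suc m ⊗ 1# + suc n ⊗ 1#)         ≈⟨ ⁻¹-∙-comm _ _ ⟨
      - (suc m ⊗ 1#) - suc n ⊗ 1#         ∎

    fromℤ-+* : ∀ m j → fromℤ (+ m ℤ.* j) ≈ m ⊗ 1# * fromℤ j
    fromℤ-+* m (+ n) = begin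
      fromℤ (+ m ℤ.* + n)  ≡⟨ ≡.cong fromℤ (≡.sym (ℤ.pos-* m n)) ⟩
      (m ℕ.* n) ⊗ 1#       ≈⟨ ×1-homo-* m n ⟩
      m ⊗ 1# * (n ⊗ 1#)    ∎
    fromℤ-+* m -[1+ n ] = begin
      fromℤ (+ m ℤ.* -[1+ n ])          ≡⟨ ≡.cong fromℤ (≡.sym (ℤ.neg-distribʳ-* (+ m) (+ suc n))) ⟩
      fromℤ (ℤ.- (+ m ℤ.* + suc n))     ≈⟨ fromℤ-neg (+ m ℤ.* + suc n) ⟩
      - fromℤ (+ m ℤ.* + suc n)         ≈⟨ -‿cong (fromℤ-+* m (+ suc n)) ⟩
      - (m ⊗ 1# * (suc n ⊗ 1#))         ≈⟨ -‿distribʳ-* _ _ ⟩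
      m ⊗ 1# * - (suc n ⊗ 1#)           ∎

    fromℤ-* : ∀ i j → fromℤ (i ℤ.* j) ≈ fromℤ i * fromℤ j
    fromℤ-* (+ m)    j = fromℤ-+* m j
    fromℤ-* -[1+ m ] j = begin
      fromℤ (-[1+ m ] ℤ.* j)            ≡⟨ ≡.cong fromℤ (≡.sym (ℤ.neg-distribˡ-* (+ suc m) j)) ⟩
      fromℤ (ℤ.- (+ suc m ℤ.* j))       ≈⟨ fromℤ-neg (+ suc m ℤ.* j) ⟩
      - fromℤ (+ suc m ℤ.* j)           ≈⟨ -‿cong (fromℤ-+* (suc m) j) ⟩
      - (suc m ⊗ 1# * fromℤ j)          ≈⟨ -‿distribˡ-* _ _ ⟩
      - (suc m ⊗ 1#) * fromℤ j          ∎

    ℤ-rawRing : RawRing _ _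
    ℤ-rawRing = CommutativeRing.rawRing ℤ.+-*-commutativeRing

    homomorphism : ℤ-rawRing -Raw-AlmostCommutative⟶ fromCommutativeRing R
    homomorphism = record
      { ⟦_⟧    = fromℤ
      ; +-homo = fromℤ-+
      ; *-homo = fromℤ-*
      ; -‿homo = fromℤ-neg
      ; 0-homo = refl
      ; 1-homo = refl
      }

    _coeff≟_ : ∀ i j → Maybe (fromℤ i ≈ fromℤ j)
    i coeff≟ j with i ℤ.≟ j
    ... | yes ≡.refl = just refl
    ... | no  _      = nothing

  open import Algebra.Solver.Ring ℤ-rawRing (fromCommutativeRing R) homomorphism _coeff≟_ public
    hiding (solve; prove)

  private
    normal-≈ : ∀ {n} (e₁ e₂ : Polynomial n) → Bool.T (is-just (normalise e₁ ≟N normalise e₂)) → ∀ ρ →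
      ⟦ e₁ ⟧ ρ ≈ ⟦ e₂ ⟧ ρ
    normal-≈ e₁ e₂ same ρ with normalise e₁ ≟N normalise e₂
    ... | just e₁≈e₂ = trans (sym (correct e₁ ρ)) (trans (⟦ e₁≈e₂ ⟧N-cong ρ) (correct e₂ ρ))

  -- Unlike the library's `solve`, this compares normal forms by evaluating the weak decision procedure,
  -- so that no normal form occurs in the proof term.
  solve : ∀ n (f : N-ary n (Polynomial n) (Polynomial n × Polynomial n)) →
         let e₁ , e₂ = f $ⁿ Vec.map var (Vec.allFin n) in
         {_ : Bool.T (is-just (normalise e₁ ≟N normalise e₂))} → Eq n _≈_ (curryⁿ ⟦ e₁ ⟧) (curryⁿ ⟦ e₂ ⟧)
  solve n f {same} = let e₁ , e₂ = f $ⁿ Vec.map var (Vec.allFin n) in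
    curryⁿ-cong _≈_ ⟦ e₁ ⟧ ⟦ e₂ ⟧ (normal-≈ e₁ e₂ same)

  -- Numerals such as `9972 · q` in the expansion are unary sums; as constants of the solver they
  -- need not be unfolded.
  ·-con : ∀ m x → m U.× x ≈ ⟦ con {0} (+ m) ⟧ Vec.[] * x
  ·-con m x = begin
    m U.× x                ≈⟨ U.×-congʳ m (*-identityˡ x) ⟨
    m U.× (1# * x)         ≈⟨ U.×-assoc-* m 1# x ⟨
    m U.× 1# * x           ≈⟨ *-congʳ (×ᵤ≈× m 1#) ⟩
    m ⊗ 1# * x             ∎

-- Constructive order, absolute bounds and limits

module OrderedFieldProperties {c ℓ₁ ℓ₂} (ℝ : Reals c ℓ₁ ℓ₂) where

  open TwoPhaseGame ℝ hiding (zero)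
  open HeytingProperties heytingCommutativeRing using (invertibleʳ⇒#)
  open IntegerRingSolver commutativeRing public
    using (Polynomial; solve; _:=_; _:+_; _:*_; _:-_; :-_; _:^_; con; var; Normal; HNF; poly; ∅; _*x+_; 0N;
      _≟N_; normalise; ⟦_⟧; ⟦_⟧N; ⟦_⟧H; correct; 0≈⟦0⟧; ·-con)
  open CommutativeRing commutativeRing public using (semiring)
  open SemiringMult semiring public using (×-homo-+; ×1-homo-*)
  open SemiringExp semiring public using (^-congˡ; ^-homo-*)

  private
    variable
      x y z u v a b ε : Carrier

  -- Substitutes for trichotomy; it is inherited from the cotransitivity of apartness.
  <-cotrans : x < y → ∀ z → x < z ⊎ z < y
  <-cotrans x<y z with #-cotrans (<⇒# x<y) z
  ... | inj₁ x#z with #⇒<⊎> x#z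
  ...   | inj₁ x<z = inj₁ x<z
  ...   | inj₂ z<x = inj₂ (<-trans z<x x<y)
  <-cotrans x<y z | inj₂ z#y with #⇒<⊎> z#y
  ...   | inj₁ z<y = inj₂ z<y
  ...   | inj₂ y<z = inj₁ (<-trans x<y y<z)

  ≤-reflexive : x ≈ y → x ≤ y
  ≤-reflexive x≈y y<x = <-irrefl (sym x≈y) y<x

  ≤-refl : x ≤ x
  ≤-refl = ≤-reflexive refl

  <⇒≤ : x < y → x ≤ y
  <⇒≤ x<y y<x = <-irrefl refl (<-trans x<y y<x)

  <-≤-trans : x < y → y ≤ z → x < z
  <-≤-trans {z = z} x<y y≤z with <-cotrans x<y z
  ... | inj₁ x<z = x<z
  ... | inj₂ z<y = contradiction z<y y≤z

  ≤-<-trans : x ≤ y → y < z → x < z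
  ≤-<-trans {x = x} x≤y y<z with <-cotrans y<z x
  ... | inj₁ y<x = contradiction y<x x≤y
  ... | inj₂ x<z = x<z

  ≤-trans : x ≤ y → y ≤ z → x ≤ z
  ≤-trans x≤y y≤z z<x = x≤y (≤-<-trans y≤z z<x)

  ≤-respˡ : x ≈ y → x ≤ z → y ≤ z
  ≤-respˡ x≈y = ≤-trans (≤-reflexive (sym x≈y))

  ≤-respʳ : x ≈ y → z ≤ x → z ≤ y
  ≤-respʳ x≈y z≤x = ≤-trans z≤x (≤-reflexive x≈y)

  ≤-antisym : x ≤ y → y ≤ x → x ≈ y
  ≤-antisym {x} {y} x≤y y≤x = proj₁ (tight x y) λ x#y → [ y≤x , x≤y ]′ (#⇒<⊎> x#y)

  +-monoˡ-≤ : ∀ z → x ≤ y → x + z ≤ y + z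
  +-monoˡ-≤ {x} {y} z x≤y y+z<x+z = x≤y (<-respˡ-≈ (undo y) (<-respʳ-≈ (undo x) (+-monoˡ-< (- z) y+z<x+z)))
    where
    undo : ∀ w → w + z - z ≈ w
    undo w = solve 2 (λ w z → w :+ z :- z := w) w z

  +-mono-≤ : x ≤ y → u ≤ v → x + u ≤ y + v
  +-mono-≤ {x} {y} {u} {v} x≤y u≤v =
    ≤-trans (+-monoˡ-≤ u x≤y) (≤-respˡ (+-comm u y) (≤-respʳ (+-comm v y) (+-monoˡ-≤ y u≤v)))

  -- Inequalities are mostly proved by exhibiting the difference as a visibly nonnegative term.
  ≤-by : ∀ d → 0# ≤ d → x + d ≈ y → x ≤ y
  ≤-by {x} d 0≤d x+d≈y =
    ≤-respˡ (+-identityʳ x) (≤-respʳ x+d≈y (≤-respˡ (+-comm 0# x) (≤-respʳ (+-comm d x) (+-monoˡ-≤ x 0≤d))))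

  <-by : ∀ d → 0# < d → x + d ≈ y → x < y
  <-by {x} d 0<d x+d≈y = <-respˡ-≈ (+-identityˡ x) (<-respʳ-≈ (trans (+-comm d x) x+d≈y) (+-monoˡ-< x 0<d))

  0≤y-x : x ≤ y → 0# ≤ y - x
  0≤y-x {x} x≤y = ≤-respˡ (-‿inverseʳ x) (+-monoˡ-≤ (- x) x≤y)

  0≤1 : 0# ≤ 1#
  0≤1 = <⇒≤ 0<1

  0≤+ : 0# ≤ x → 0# ≤ y → 0# ≤ x + y
  0≤+ 0≤x 0≤y = ≤-respˡ (+-identityˡ 0#) (+-mono-≤ 0≤x 0≤y)

  0<+ : 0# < x → 0# ≤ y → 0# < x + y
  0<+ {x} {y} 0<x 0≤y = <-≤-trans 0<x (≤-by y 0≤y refl)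

  _⁻¹ : ∀ {x} → x # 0# → Carrier
  x#0 ⁻¹ = proj₁ (#⇒invertible x#0)

  ⁻¹-inverse : ∀ (x#0 : x # 0#) → x * x#0 ⁻¹ ≈ 1#
  ⁻¹-inverse {x} x#0 = trans (*-congʳ (sym (x-0≈x x))) (proj₂ (proj₂ (#⇒invertible x#0)))

  xy≈1⇒x#0 : x * y ≈ 1# → x # 0#
  xy≈1⇒x#0 {x} {y} xy≈1 = invertibleʳ⇒# (y , trans (*-congʳ (x-0≈x x)) xy≈1)

  xy#0⇒x#0 : x * y # 0# → x # 0#
  xy#0⇒x#0 {x} {y} xy#0 = xy≈1⇒x#0 (trans (sym (*-assoc x y _)) (⁻¹-inverse xy#0))

  -- As `_≤_` is a negation, xy < 0 may be assumed. Then xy is invertible, hence so are x and y, and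
  -- only now can their signs be distinguished.
  0≤* : 0# ≤ x → 0# ≤ y → 0# ≤ x * y
  0≤* {x} {y} 0≤x 0≤y xy<0
    with #⇒<⊎> (xy#0⇒x#0 (<⇒# xy<0)) | #⇒<⊎> (xy#0⇒x#0 (#-congʳ (*-comm x y) (<⇒# xy<0)))
  ... | inj₁ x<0 | _        = 0≤x x<0
  ... | inj₂ _   | inj₁ y<0 = 0≤y y<0
  ... | inj₂ 0<x | inj₂ 0<y = <⇒≤ (*-pos 0<x 0<y) xy<0

  *-monoʳ-≤ : 0# ≤ z → x ≤ y → z * x ≤ z * y
  *-monoʳ-≤ {z} {x} {y} 0≤z x≤y = ≤-by (z * (y - x)) (0≤* 0≤z (0≤y-x x≤y))
    (solve 3 (λ x y z → z :* x :+ z :* (y :- x) := z :* y) x y z)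

  *-mono-≤ : 0# ≤ x → x ≤ y → 0# ≤ u → u ≤ v → x * u ≤ y * v
  *-mono-≤ {x} {y} {u} {v} 0≤x x≤y 0≤u u≤v = ≤-trans (*-monoʳ-≤ 0≤x u≤v)
    (≤-respˡ (*-comm v x) (≤-respʳ (*-comm v y) (*-monoʳ-≤ (≤-trans 0≤u u≤v) x≤y)))

  0≤^ : 0# ≤ x → ∀ k → 0# ≤ x ^ k
  0≤^ 0≤x zero    = 0≤1
  0≤^ 0≤x (suc k) = 0≤* 0≤x (0≤^ 0≤x k)

  0<^ : 0# < x → ∀ k → 0# < x ^ k
  0<^ 0<x zero    = 0<1
  0<^ 0<x (suc k) = *-pos 0<x (0<^ 0<x k)

  ^-monoˡ-≤ : 0# ≤ x → x ≤ y → ∀ k → x ^ k ≤ y ^ k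
  ^-monoˡ-≤ 0≤x x≤y zero    = ≤-refl
  ^-monoˡ-≤ 0≤x x≤y (suc k) = *-mono-≤ 0≤x x≤y (0≤^ 0≤x k) (^-monoˡ-≤ 0≤x x≤y k)

  1^≈1 : ∀ k → 1# ^ k ≈ 1#
  1^≈1 zero    = refl
  1^≈1 (suc k) = trans (*-identityˡ _) (1^≈1 k)

  ^-distrib-* : ∀ x y k → (x * y) ^ k ≈ x ^ k * y ^ k
  ^-distrib-* x y zero    = sym (*-identityˡ 1#)
  ^-distrib-* x y (suc k) = trans (*-congˡ (^-distrib-* x y k))
    (solve 4 (λ x y X Y → x :* y :* (X :* Y) := x :* X :* (y :* Y)) x y (x ^ k) (y ^ k))

  0<x⇒x#0 : 0# < x → x # 0#
  0<x⇒x#0 0<x = #-sym (<⇒# 0<x)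

  0<⁻¹ : (0<x : 0# < x) → 0# < 0<x⇒x#0 0<x ⁻¹
  0<⁻¹ {x} 0<x with #⇒<⊎> (xy≈1⇒x#0 (trans (*-comm _ x) (⁻¹-inverse (0<x⇒x#0 0<x))))
  ... | inj₂ 0<i = 0<i
  ... | inj₁ i<0 = contradiction (*-pos 0<x (x<y⇒0<y-x i<0)) (<⇒≤ (<-by 1# 0<1 (begin
    x * (0# - i) + 1#     ≈⟨ +-congˡ (⁻¹-inverse (0<x⇒x#0 0<x)) ⟨
    x * (0# - i) + x * i  ≈⟨ solve 2 (λ x i → x :* (con (+ 0) :- i) :+ x :* i := con (+ 0)) x i ⟩
    0#                    ∎)))
    where
    open SetoidReasoning setoid
    i = 0<x⇒x#0 0<x ⁻¹

  *-cancelˡ-< : 0# < z → z * x < z * y → x < y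
  *-cancelˡ-< {z} {x} {y} 0<z zx<zy = <-by (i * (z * y - z * x)) (*-pos (0<⁻¹ 0<z) (x<y⇒0<y-x zx<zy)) (begin
    x + i * (z * y - z * x)
      ≈⟨ solve 4 (λ x y z i → x :+ i :* (z :* y :- z :* x) := x :+ z :* i :* (y :- x)) x y z i ⟩
    x + z * i * (y - x)      ≈⟨ +-congˡ (*-congʳ (⁻¹-inverse (0<x⇒x#0 0<z))) ⟩
    x + 1# * (y - x)         ≈⟨ solve 2 (λ x y → x :+ con (+ 1) :* (y :- x) := y) x y ⟩
    y                        ∎)
    where
    open SetoidReasoning setoid
    i = 0<x⇒x#0 0<z ⁻¹

  *-monoʳ-< : 0# < z → x < y → z * x < z * y
  *-monoʳ-< {z} {x} {y} 0<z x<y = <-by (z * (y - x)) (*-pos 0<z (x<y⇒0<y-x x<y))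
    (solve 3 (λ x y z → z :* x :+ z :* (y :- x) := z :* y) x y z)

  *-cancelˡ-≤ : 0# < z → z * x ≤ z * y → x ≤ y
  *-cancelˡ-≤ 0<z zx≤zy y<x = zx≤zy (*-monoʳ-< 0<z y<x)

  *-cancelˡ-≈ : 0# < z → z * x ≈ z * y → x ≈ y
  *-cancelˡ-≈ 0<z zx≈zy =
    ≤-antisym (*-cancelˡ-≤ 0<z (≤-reflexive zx≈zy)) (*-cancelˡ-≤ 0<z (≤-reflexive (sym zx≈zy)))

  0<½ : 0# < ½
  0<½ = *-pos 0<1 (0<⁻¹ (0<suc·1 1))

  x≈½x+½x : ∀ x → ½ * x + ½ * x ≈ x
  x≈½x+½x x = trans (sym (distribʳ x ½ ½)) (trans (*-congʳ ½+½≈1) (*-identityˡ x))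

  0≤x+x⇒0≤x : 0# ≤ x + x → 0# ≤ x
  0≤x+x⇒0≤x 0≤x+x x<0 = 0≤x+x (<-respʳ-≈ (+-identityˡ 0#) (+-mono-< x<0 x<0))

  ≤-by-<ε : (∀ ε → 0# < ε → x ≤ y + ε) → x ≤ y
  ≤-by-<ε {x} {y} x≤y+ε y<x = x≤y+ε (½ * d) 0<½d (<-by (½ * d) 0<½d (begin
    y + ½ * d + ½ * d    ≈⟨ +-assoc y (½ * d) (½ * d) ⟩
    y + (½ * d + ½ * d)  ≈⟨ +-congˡ (x≈½x+½x d) ⟩
    y + (x - y)          ≈⟨ solve 2 (λ x y → y :+ (x :- y) := x) x y ⟩
    x                    ∎))
    where
    open SetoidReasoning setoid
    d = x - y
    0<½d = *-pos 0<½ (x<y⇒0<y-x y<x)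

  ∣∣≤⇒0≤ : ∣ x ∣≤ b → 0# ≤ b
  ∣∣≤⇒0≤ {x} {b} (-b≤x , x≤b) = 0≤x+x⇒0≤x (≤-respʳ
    (solve 2 (λ x b → x :- :- b :+ (b :- x) := b :+ b) x b) (0≤+ (0≤y-x -b≤x) (0≤y-x x≤b)))

  ∣∣≤-resp : x ≈ y → ∣ x ∣≤ b → ∣ y ∣≤ b
  ∣∣≤-resp x≈y (l , u) = ≤-respʳ x≈y l , ≤-respˡ x≈y u

  ∣∣≤-weaken : a ≤ b → ∣ x ∣≤ a → ∣ x ∣≤ b
  ∣∣≤-weaken {a} {b} a≤b (l , u) =
    ≤-trans (≤-by (b - a) (0≤y-x a≤b) (solve 2 (λ a b → :- b :+ (b :- a) := :- a) a b)) l , ≤-trans u a≤b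

  ∣∣≤-neg : ∣ x ∣≤ b → ∣ - x ∣≤ b
  ∣∣≤-neg {x} {b} (l , u) =
    ≤-by (b - x) (0≤y-x u) (solve 2 (λ x b → :- b :+ (b :- x) := :- x) x b) ,
    ≤-by (x - - b) (0≤y-x l) (solve 2 (λ x b → :- x :+ (x :- :- b) := b) x b)

  ∣∣≤-+ : ∣ x ∣≤ a → ∣ y ∣≤ b → ∣ x + y ∣≤ a + b
  ∣∣≤-+ {a = a} {b = b} (l , u) (l′ , u′) =
    ≤-respˡ (solve 2 (λ a b → :- a :+ :- b := :- (a :+ b)) a b) (+-mono-≤ l l′) , +-mono-≤ u u′

  ∣∣≤-minus : ∣ x ∣≤ a → ∣ y ∣≤ b → ∣ x - y ∣≤ a + b
  ∣∣≤-minus ∣x∣≤a ∣y∣≤b = ∣∣≤-+ ∣x∣≤a (∣∣≤-neg ∣y∣≤b)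

  -- Without cases on signs: (x + a)(y + b) + (a - x)(b - y) = 2(ab + xy) has nonnegative summands,
  -- and likewise with -y for y.
  ∣∣≤-* : ∣ x ∣≤ a → ∣ y ∣≤ b → ∣ x * y ∣≤ a * b
  ∣∣≤-* {x} {a} {y} {b} (l , u) (l′ , u′) =
    ≤-by (a * b + x * y) (0≤x+x⇒0≤x (≤-respʳ
      (solve 4 (λ x y a b → (x :- :- a) :* (y :- :- b) :+ (a :- x) :* (b :- y) :=
        a :* b :+ x :* y :+ (a :* b :+ x :* y)) x y a b)
      (0≤+ (0≤* (0≤y-x l) (0≤y-x l′)) (0≤* (0≤y-x u) (0≤y-x u′)))))
      (solve 2 (λ c d → :- c :+ (c :+ d) := d) (a * b) (x * y)) ,
    ≤-by (a * b - x * y) (0≤x+x⇒0≤x (≤-respʳ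
      (solve 4 (λ x y a b → (x :- :- a) :* (b :- y) :+ (a :- x) :* (y :- :- b) :=
        a :* b :- x :* y :+ (a :* b :- x :* y)) x y a b)
      (0≤+ (0≤* (0≤y-x l) (0≤y-x u′)) (0≤* (0≤y-x u) (0≤y-x l′)))))
      (solve 2 (λ c d → d :+ (c :- d) := c) (a * b) (x * y))

  0≤⇒∣∣≤ : 0# ≤ x → x ≤ b → ∣ x ∣≤ b
  0≤⇒∣∣≤ {x} {b} 0≤x x≤b =
    ≤-by (b + x) (0≤+ (≤-trans 0≤x x≤b) 0≤x) (solve 2 (λ x b → :- b :+ (b :+ x) := x) x b) , x≤b

  ∣0∣≤ : 0# ≤ b → ∣ 0# ∣≤ b
  ∣0∣≤ 0≤b = 0≤⇒∣∣≤ ≤-refl 0≤b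

  ∣∣≤-by-<ε : (∀ ε → 0# < ε → ∣ x ∣≤ ε + b) → ∣ x ∣≤ b
  ∣∣≤-by-<ε {x} {b} close =
    ≤-by-<ε (λ ε 0<ε → ≤-by (x - - (ε + b)) (0≤y-x (proj₁ (close ε 0<ε)))
      (solve 3 (λ x ε b → :- b :+ (x :- :- (ε :+ b)) := x :+ ε) x ε b)) ,
    ≤-by-<ε (λ ε 0<ε → ≤-respʳ (+-comm ε b) (proj₂ (close ε 0<ε)))

  0≤n·1 : ∀ n → 0# ≤ n · 1#
  0≤n·1 zero    = ≤-refl
  0≤n·1 (suc n) = <⇒≤ (0<suc·1 n)

  ·1-mono-≤ : ∀ {m n} → m ℕ.≤ n → m · 1# ≤ n · 1#
  ·1-mono-≤ {n = n} ℕ.z≤n = 0≤n·1 n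
  ·1-mono-≤ (ℕ.s≤s m≤n)   = +-mono-≤ ≤-refl (·1-mono-≤ m≤n)

  bounded : ∀ x → ∃[ b ] ∣ x ∣≤ b
  bounded x with archimedean x | archimedean (- x)
  ... | m , x<m | n , -x<n = m · 1# + n · 1# ,
    ≤-by (x + (m · 1# + n · 1#)) (≤-by (n · 1# - - x + m · 1#) (0≤+ (0≤y-x (<⇒≤ -x<n)) (0≤n·1 m))
      (solve 3 (λ x m n → con (+ 0) :+ (n :- :- x :+ m) := x :+ (m :+ n)) x (m · 1#) (n · 1#)))
      (solve 2 (λ x b → :- b :+ (x :+ b) := x) x (m · 1# + n · 1#)) ,
    ≤-trans (<⇒≤ x<m) (≤-by (n · 1#) (0≤n·1 n) refl)

  module _ {θ : Carrier} (0≤θ : 0# ≤ θ) (θ<1 : θ < 1#) where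

    ^≤1 : ∀ k → θ ^ k ≤ 1#
    ^≤1 k = ≤-respʳ (1^≈1 k) (^-monoˡ-≤ 0≤θ (<⇒≤ θ<1) k)

    -- Bernoulli's inequality for 1/θ, without the division.
    [1-θ]kθᵏ≤1 : ∀ k → (1# - θ) * (k · 1#) * θ ^ k ≤ 1#
    [1-θ]kθᵏ≤1 k = ≤-trans (≤-by (θ ^ k) (0≤^ 0≤θ k) refl) (strong k)
      where
      strong : ∀ k → (1# - θ) * (k · 1#) * θ ^ k + θ ^ k ≤ 1#
      strong zero    =
        ≤-reflexive (solve 1 (λ θ → (con (+ 1) :- θ) :* con (+ 0) :* con (+ 1) :+ con (+ 1) := con (+ 1)) θ)
      strong (suc k) = ≤-by (θ * (1# - s) + (1# - θ) * (1# - θ * θ ^ k))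
        (0≤+ (0≤* 0≤θ (0≤y-x (strong k))) (0≤* (0≤y-x (<⇒≤ θ<1)) (0≤y-x (^≤1 (suc k)))))
        (solve 3 (λ θ k̂ t → let s = (con (+ 1) :- θ) :* k̂ :* t :+ t in
            (con (+ 1) :- θ) :* (con (+ 1) :+ k̂) :* (θ :* t) :+ θ :* t :+
              (θ :* (con (+ 1) :- s) :+ (con (+ 1) :- θ) :* (con (+ 1) :- θ :* t)) := con (+ 1)) θ (k · 1#)
                (θ ^ k))
        where s = (1# - θ) * (k · 1#) * θ ^ k + θ ^ k

    -- N lies beyond C / ((1 - θ)ε). After multiplication by (1 - θ)k, the left side is at most C by
    -- the preceding inequality, and the right side exceeds C.
    geometric-small : ∀ C → 0# ≤ C → ∀ ε → 0# < ε → ∃[ N ] ∀ k → N ℕ.≤ k → C * θ ^ k < ε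
    geometric-small C 0≤C ε 0<ε with archimedean (C * 0<x⇒x#0 (*-pos (x<y⇒0<y-x θ<1) 0<ε) ⁻¹)
    ... | N , C/[1-θ]ε<N = N , λ k N≤k → *-cancelˡ-< (0<m k N≤k) (≤-<-trans (lower k) (upper k N≤k))
      where
      open SetoidReasoning setoid
      0<1-θ = x<y⇒0<y-x θ<1
      0<s = *-pos 0<1-θ 0<ε
      s⁻¹ = 0<x⇒x#0 0<s ⁻¹
      C/s<k : ∀ k → N ℕ.≤ k → C * s⁻¹ < k · 1#
      C/s<k k N≤k = <-≤-trans C/[1-θ]ε<N (·1-mono-≤ N≤k)
      m : ℕ → Carrier
      m k = (1# - θ) * (k · 1#)
      0<m : ∀ k → N ℕ.≤ k → 0# < m k
      0<m k N≤k = *-pos 0<1-θ (≤-<-trans (0≤* 0≤C (<⇒≤ (0<⁻¹ 0<s))) (C/s<k k N≤k))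
      lower : ∀ k → m k * (C * θ ^ k) ≤ C
      lower k = ≤-respˡ (solve 3 (λ m C t → C :* (m :* t) := m :* (C :* t)) (m k) C (θ ^ k))
        (≤-respʳ (*-identityʳ C) (*-monoʳ-≤ 0≤C ([1-θ]kθᵏ≤1 k)))
      upper : ∀ k → N ℕ.≤ k → C < m k * ε
      upper k N≤k = <-respˡ-≈ (begin
          (1# - θ) * ε * (C * s⁻¹)  ≈⟨ solve 3 (λ s C i → s :* (C :* i) := C :* (s :* i)) _ C s⁻¹ ⟩
          C * ((1# - θ) * ε * s⁻¹)  ≈⟨ *-congˡ (⁻¹-inverse (0<x⇒x#0 0<s)) ⟩
          C * 1#                    ≈⟨ *-identityʳ C ⟩
          C                         ∎)
        (<-respʳ-≈ (solve 3 (λ a ε k → a :* ε :* k := a :* k :* ε) (1# - θ) ε (k · 1#))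
          (*-monoʳ-< 0<s (C/s<k k N≤k)))

  ∣∣≤∧<⇒∣∣< : ∣ x ∣≤ b → b < ε → ∣ x ∣< ε
  ∣∣≤∧<⇒∣∣< {x} {b} {ε} (l , u) b<ε =
    <-≤-trans (<-by (ε - b) (x<y⇒0<y-x b<ε) (solve 2 (λ b ε → :- ε :+ (ε :- b) := :- b) b ε)) l ,
      ≤-<-trans u b<ε

  ∣∣<⇒∣∣≤ : ∣ x ∣< ε → ∣ x ∣≤ ε
  ∣∣<⇒∣∣≤ (l , u) = <⇒≤ l , <⇒≤ u

  -- Limits of sequences

  private
    variable
      s t : ℕ → Carrier
      k l : Carrier

  ⟶-resp : (∀ n → s n ≈ t n) → k ≈ l → s ⟶ k → t ⟶ l
  ⟶-resp s≈t k≈l s⟶k ε 0<ε with s⟶k ε 0<ε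
  ... | N , close = N , λ n N≤n →
    let eq = +-cong (s≈t n) (-‿cong k≈l); lo , hi = close n N≤n in <-respʳ-≈ eq lo , <-respˡ-≈ eq hi

  ⟶-geometric : ∀ {θ C} → 0# ≤ θ → θ < 1# → (∀ n → ∣ l - s n ∣≤ C * θ ^ n) → s ⟶ l
  ⟶-geometric {l} {s} {θ} {C} 0≤θ θ<1 close ε 0<ε =
    let N , small = geometric-small 0≤θ θ<1 C (∣∣≤⇒0≤ (∣∣≤-weaken (≤-reflexive (*-identityʳ C)) (close 0))) ε 0<ε
    in N , λ n N≤n → ∣∣≤∧<⇒∣∣<
    (∣∣≤-resp (solve 2 (λ l s → :- (l :- s) := s :- l) l (s n)) (∣∣≤-neg (close n))) (small n N≤n)

  ⟶-+ : s ⟶ k → t ⟶ l → (λ n → s n + t n) ⟶ (k + l)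
  ⟶-+ {s} {k} {t} {l} s⟶k t⟶l ε 0<ε
    = let M , s-close = s⟶k (½ * ε) (*-pos 0<½ 0<ε)
          N , t-close = t⟶l (½ * ε) (*-pos 0<½ 0<ε)
      in M ℕ.⊔ N , λ n M⊔N≤n →
    let s-lo , s-hi = s-close n (ℕ.≤-trans (ℕ.m≤m⊔n M N) M⊔N≤n)
        t-lo , t-hi = t-close n (ℕ.≤-trans (ℕ.m≤n⊔m M N) M⊔N≤n)
        eq = solve 4 (λ s k t l → s :- k :+ (t :- l) := s :+ t :- (k :+ l)) (s n) k (t n) l
    in <-respˡ-≈ (trans (solve 1 (λ h → :- h :+ :- h := :- (h :+ h)) (½ * ε)) (-‿cong (x≈½x+½x ε)))
         (<-respʳ-≈ eq (+-mono-< s-lo t-lo)) ,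
       <-respʳ-≈ (x≈½x+½x ε) (<-respˡ-≈ eq (+-mono-< s-hi t-hi))

  ⟶-* : ∀ x → s ⟶ l → (λ n → x * s n) ⟶ (x * l)
  ⟶-* {s} {l} x s⟶l ε 0<ε = let N , close = s⟶l (i * ε) (*-pos (0<⁻¹ 0<1+b) 0<ε) in N , λ n N≤n → ∣∣≤∧<⇒∣∣<
    (∣∣≤-resp (solve 3 (λ x s l → x :* (s :- l) := x :* s :- x :* l) x (s n) l)
      (∣∣≤-* ∣x∣≤β (∣∣<⇒∣∣≤ (close n N≤n))))
    (<-by (i * ε) (*-pos (0<⁻¹ 0<1+b) 0<ε) (begin
      β * (i * ε) + i * ε
        ≈⟨ solve 3 (λ b i ε → b :* (i :* ε) :+ i :* ε := (con (+ 1) :+ b) :* i :* ε) β i ε ⟩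
      (1# + β) * i * ε     ≈⟨ *-congʳ (⁻¹-inverse (0<x⇒x#0 0<1+b)) ⟩
      1# * ε               ≈⟨ *-identityˡ ε ⟩
      ε                    ∎))
    where
    open SetoidReasoning setoid
    β = proj₁ (bounded x)
    ∣x∣≤β = proj₂ (bounded x)
    -- The bound `β` may be 0, so ε is divided by 1 + β.
    0<1+b = 0<+ 0<1 (∣∣≤⇒0≤ ∣x∣≤β)
    i = 0<x⇒x#0 0<1+b ⁻¹

  ⟶-suc : (λ n → s (suc n)) ⟶ l → s ⟶ l
  ⟶-suc s⟶l ε 0<ε with s⟶l ε 0<ε
  ... | N , close = suc N , λ { (suc n) (ℕ.s≤s N≤n) → close n N≤n }

  ⟶-unique : s ⟶ k → s ⟶ l → k ≈ l
  ⟶-unique {s} {k} {l} s⟶k s⟶l = ≤-antisym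
    (≤-by-<ε λ ε 0<ε → below (s⟶k (½ * ε) (*-pos 0<½ 0<ε)) (s⟶l (½ * ε) (*-pos 0<½ 0<ε)))
    (≤-by-<ε λ ε 0<ε → below (s⟶l (½ * ε) (*-pos 0<½ 0<ε)) (s⟶k (½ * ε) (*-pos 0<½ 0<ε)))
    where
    Near : Carrier → Carrier → Set _
    Near l ε = ∃[ N ] ∀ n → N ℕ.≤ n → ∣ s n - l ∣< ε
    gap : ∀ {k l ε} x → ∣ x - k ∣< ½ * ε → ∣ x - l ∣< ½ * ε → k ≤ l + ε
    gap {k} {l} {ε} x (lo , _) (_ , hi) =
      ≤-by (x - k - - (½ * ε) + (½ * ε - (x - l))) (0≤+ (0≤y-x (<⇒≤ lo)) (0≤y-x (<⇒≤ hi)))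
        (trans (solve 4 (λ x k l h → k :+ (x :- k :- :- h :+ (h :- (x :- l))) := l :+ (h :+ h)) x k l (½ * ε))
          (+-congˡ (x≈½x+½x ε)))
    below : ∀ {k l ε} → Near k (½ * ε) → Near l (½ * ε) → k ≤ l + ε
    below (M , near-k) (N , near-l) =
      gap (s (M ℕ.⊔ N)) (near-k (M ℕ.⊔ N) (ℕ.m≤m⊔n M N)) (near-l (M ℕ.⊔ N) (ℕ.m≤n⊔m M N))

  -- Identities modulo a relation u ≈ v are reduced to ring identities by exhibiting the cofactor of u - v.
  modulo : ∀ {x y u v} c → u ≈ v → x ≈ y + (u - v) * c → x ≈ y
  modulo {x} {y} {u} {v} c u≈v x≈ = begin
    x                ≈⟨ x≈ ⟩
    y + (u - v) * c  ≈⟨ +-congˡ (*-congʳ (+-congʳ u≈v)) ⟩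
    y + (v - v) * c  ≈⟨ solve 3 (λ y v c → y :+ (v :- v) :* c := y) y v c ⟩
    y                ∎
    where open SetoidReasoning setoid

  modulo₂ : ∀ {x y u v s t} c d → u ≈ v → s ≈ t → x ≈ y + ((u - v) * c + (s - t) * d) → x ≈ y
  modulo₂ {x} {y} {u} {v} {s} {t} c d u≈v s≈t x≈ =
    modulo c u≈v (modulo d s≈t (trans x≈ (sym (+-assoc _ _ _))))

-- Orders of magnitude in 1/n, and their computation from polynomials

module Asymptotics {c ℓ₁ ℓ₂} (ℝ : Reals c ℓ₁ ℓ₂) where

  open TwoPhaseGame ℝ hiding (zero)
  open OrderedFieldProperties ℝ

  -- Sequences are indexed by k = n - 1, so that x k = 1 / n is defined for all k.
  ν x : ℕ → Carrier
  ν k = suc k · 1#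
  x k = 1/ suc k

  0<ν : ∀ k → 0# < ν k
  0<ν = 0<suc·1

  ν*x≈1 : ∀ k → ν k * x k ≈ 1#
  ν*x≈1 k = trans (*-congˡ (*-identityˡ _)) (⁻¹-inverse (n·1#0 (suc k)))

  0<x : ∀ k → 0# < x k
  0<x k = *-cancelˡ-< (0<ν k) (<-respˡ-≈ (sym (zeroʳ (ν k))) (<-respʳ-≈ (sym (ν*x≈1 k)) 0<1))

  0≤x : ∀ k → 0# ≤ x k
  0≤x k = <⇒≤ (0<x k)

  x≤1 : ∀ k → x k ≤ 1#
  x≤1 k = *-cancelˡ-≤ (0<ν k)
    (≤-respˡ (sym (ν*x≈1 k)) (≤-respʳ (sym (*-identityʳ (ν k))) (≤-by (k · 1#) (0≤n·1 k) refl)))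

  x-suc : ∀ k → x (suc k) * (1# + x k) ≈ x k
  x-suc k = modulo₂ (- x (suc k)) (x k) (ν*x≈1 k) (ν*x≈1 (suc k))
    (solve 3 (λ x x′ ν → x′ :* (con (+ 1) :+ x) :=
      x :+ ((ν :* x :- con (+ 1)) :* :- x′ :+ ((con (+ 1) :+ ν) :* x′ :- con (+ 1)) :* x))
      (x k) (x (suc k)) (ν k))

  x-anti : ∀ k → x (suc k) ≤ x k
  x-anti k = ≤-respʳ (x-suc k) (≤-by (x (suc k) * x k) (0≤* (0≤x (suc k)) (0≤x k))
    (solve 2 (λ x x′ → x′ :+ x′ :* x := x′ :* (con (+ 1) :+ x)) (x k) (x (suc k))))

  -- The estimate is required at every `k`, not only eventually, so estimates combine without
  -- thresholds.
  record O (d : ℕ) (s : ℕ → Carrier) : Set (c ⊔ ℓ₂) where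
    constructor _,_
    field
      constant : Carrier
      estimate : ∀ k → ∣ s k ∣≤ constant * x k ^ d

  private
    variable
      s t : ℕ → Carrier
      d e : ℕ

  O-resp : (∀ k → s k ≈ t k) → O d s → O d t
  O-resp s≈t (C , s≤) = C , λ k → ∣∣≤-resp (s≈t k) (s≤ k)

  O-+ : O d s → O d t → O d (λ k → s k + t k)
  O-+ {d} (C , s≤) (C′ , t≤) =
    C + C′ , λ k → ∣∣≤-weaken (≤-reflexive (sym (distribʳ (x k ^ d) C C′))) (∣∣≤-+ (s≤ k) (t≤ k))

  O-* : O d s → O e t → O (d ℕ.+ e) (λ k → s k * t k)
  O-* {d} {e = e} (C , s≤) (C′ , t≤) = C * C′ , λ k → ∣∣≤-weaken (≤-reflexive (trans
    (solve 4 (λ C C′ X Y → C :* X :* (C′ :* Y) := C :* C′ :* (X :* Y)) C C′ (x k ^ d) (x k ^ e))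
    (*-congˡ (sym (^-homo-* (x k) d e))))) (∣∣≤-* (s≤ k) (t≤ k))

  O-bounded : ∀ {b} → (∀ k → ∣ s k ∣≤ b) → O 0 s
  O-bounded {b = b} s≤b = b , λ k → ∣∣≤-weaken (≤-reflexive (sym (*-identityʳ b))) (s≤b k)

  O-const : ∀ z → O 0 (λ _ → z)
  O-const z = O-bounded (λ _ → proj₂ (bounded z))

  O-x : O 1 x
  O-x = 1# , λ k → 0≤⇒∣∣≤ (0≤x k) (≤-reflexive (sym (trans (*-identityˡ _) (*-identityʳ (x k)))))

  O-ν : O (suc d) s → O d (λ k → ν k * s k)
  O-ν {d} (C , s≤) = C , λ k → ∣∣≤-weaken (≤-reflexive (modulo (C * x k ^ d) (ν*x≈1 k)
    (solve 4 (λ C ν x X → ν :* (C :* (x :* X)) := C :* X :+ (ν :* x :- con (+ 1)) :* (C :* X)) C (ν k) (x k)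
      (x k ^ d))))
    (∣∣≤-* (0≤⇒∣∣≤ (<⇒≤ (0<ν k)) ≤-refl) (s≤ k))

  at : ∀ {m} → ℕ → Vec (ℕ → Carrier) m → Vec Carrier m
  at k []      = []
  at k (s ∷ σ) = s k ∷ at k σ

  mutual

    O-HNF : ∀ {m σ} → All (O 0) σ → (h : HNF (suc m)) → O 0 (λ k → ⟦ h ⟧H (at k σ))
    O-HNF σ-bounded       ∅         = O-const 0#
    O-HNF (b ∷ σ-bounded) (h *x+ e) = O-+ (O-* (O-HNF (b ∷ σ-bounded) h) b) (O-normal σ-bounded e)

    O-normal : ∀ {m σ} → All (O 0) σ → (e : Normal m) → O 0 (λ k → ⟦ e ⟧N (at k σ))
    O-normal []              (con z)  = O-const _
    O-normal σ-bounded@(_ ∷ _) (poly h) = O-HNF σ-bounded h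

  -- Passing to the Horner normal form leaves only sums and products to be estimated.
  O-polynomial : ∀ {m σ} → All (O 0) σ → (e : Polynomial m) → O 0 (λ k → ⟦ e ⟧ (at k σ))
  O-polynomial {σ = σ} σ-bounded e = O-resp (λ k → correct e (at k σ)) (O-normal σ-bounded (normalise e))

  O⇒0≤ : (s-O : O d s) → 0# ≤ O.constant s-O
  O⇒0≤ {d} (C , s≤) =
    *-cancelˡ-≤ (0<^ (0<x 0) d) (≤-respˡ (sym (zeroʳ _)) (≤-respʳ (*-comm C _) (∣∣≤⇒0≤ (s≤ 0))))

  O-weaken : O (suc d) s → O d s
  O-weaken {d} s-O@(C , s≤) = C , λ k → ∣∣≤-weaken (*-monoʳ-≤ (O⇒0≤ s-O) (≤-by ((1# - x k) * x k ^ d)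
    (0≤* (0≤y-x (x≤1 k)) (0≤^ (0≤x k) d))
      (solve 2 (λ x X → x :* X :+ (con (+ 1) :- x) :* X := X) (x k) (x k ^ d)))) (s≤ k)

  -- In Horner form, divisibility by the d-th power of the first variable shows in the d outermost
  -- constant terms, which must be zero.
  divisible : ∀ {m} → ℕ → HNF (suc m) → Bool
  divisible zero    _         = true
  divisible (suc d) ∅         = true
  divisible (suc d) (h *x+ e) = is-just (e ≟N 0N) ∧ divisible d h

  O-divisible : ∀ {m σ} {ρ : Vec (ℕ → Carrier) m} d h → Bool.T (divisible d h) → O 1 σ → All (O 0) ρ →
    O d (λ k → ⟦ h ⟧H (σ k ∷ at k ρ))
  O-divisible zero    h         _  σ-small ρ-bounded = O-HNF (O-weaken σ-small ∷ ρ-bounded) h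
  O-divisible (suc d) ∅         _  σ-small ρ-bounded = 0# , λ k → ∣0∣≤ (≤-reflexive (sym (zeroˡ _)))
  O-divisible {σ = σ} {ρ} (suc d) (h *x+ e) h-divisible σ-small ρ-bounded with e ≟N 0N
  ... | just e≈0 =
    O-resp (λ k → trans (*-comm (σ k) _) (trans (sym (+-identityʳ _)) (+-congˡ (0≈⟦0⟧ e≈0 (at k ρ)))))
    (O-* σ-small (O-divisible d h h-divisible σ-small ρ-bounded))

  divisibleN : ∀ {m} → ℕ → Normal (suc m) → Bool
  divisibleN d (poly h) = divisible d h

  vanishes : ∀ {m} → ℕ → Polynomial (suc m) → Bool
  vanishes d e = divisibleN d (normalise e)

  -- This turns a computation into an estimate: for a concrete `e`, the type checker evaluates
  -- `vanishes d e` on the normal form, and `tt` is the proof.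
  O-vanishing : ∀ {m σ} {ρ : Vec (ℕ → Carrier) m} d e → Bool.T (vanishes d e) → O 1 σ → All (O 0) ρ →
    O d (λ k → ⟦ e ⟧ (σ k ∷ at k ρ))
  O-vanishing {σ = σ} {ρ} d e v σ-small ρ-bounded =
    O-resp (λ k → correct e (σ k ∷ at k ρ)) (small (normalise e) v)
    where
    small : ∀ f → Bool.T (divisibleN d f) → O d (λ k → ⟦ f ⟧N (σ k ∷ at k ρ))
    small (poly h) v = O-divisible d h v σ-small ρ-bounded

  O⇒⟶ : ∀ {s l} → O 1 (λ k → s k - l) → s ⟶ l
  O⇒⟶ {s} {l} s-O@(C , s≤) ε 0<ε = near (archimedean (C * ε⁻¹))
    where
    open SetoidReasoning setoid
    ε⁻¹ = 0<x⇒x#0 0<ε ⁻¹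
    near : ∃[ N ] C * ε⁻¹ < N · 1# → ∃[ N ] (∀ k → N ℕ.≤ k → ∣ s k - l ∣< ε)
    near (N , C/ε<N) = N , λ k N≤k → ∣∣≤∧<⇒∣∣< (s≤ k)
      (<-respˡ-≈ (modulo (C * x k) (⁻¹-inverse (0<x⇒x#0 0<ε))
          (solve 4 (λ C ε i x → x :* ε :* (C :* i) :=
            C :* (x :* con (+ 1)) :+ (ε :* i :- con (+ 1)) :* (C :* x)) C ε ε⁻¹ (x k)))
        (<-respʳ-≈ (modulo ε (ν*x≈1 k)
          (solve 3 (λ x ε ν → x :* ε :* ν := ε :+ (ν :* x :- con (+ 1)) :* ε) (x k) ε (ν k)))
          (*-monoʳ-< (*-pos (0<x k) 0<ε) (<-≤-trans C/ε<N (·1-mono-≤ (ℕ.m≤n⇒m≤1+n N≤k))))))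

-- First-step recursions for the series over plays

module Plays {c ℓ₁ ℓ₂} (ℝ : Reals c ℓ₁ ℓ₂) where

  open TwoPhaseGame ℝ hiding (zero)
  open OrderedFieldProperties ℝ

  ≤ᵇ-true : ∀ {m n} → m ℕ.≤ n → (m ≤ᵇ n) ≡ true
  ≤ᵇ-true {m} {n} m≤n with m ≤ᵇ n | ℕ.≤⇒≤ᵇ m≤n
  ... | true | _ = ≡.refl

  ≤ᵇ-false : ∀ {m n} → n ℕ.< m → (m ≤ᵇ n) ≡ false
  ≤ᵇ-false {m} {n} n<m with m ≤ᵇ n | ℕ.≤ᵇ⇒≤ m n
  ... | false | _   = ≡.refl
  ... | true  | m≤n = contradiction (m≤n _) (ℕ.<⇒≱ n<m)

  module PartialSums (q : Carrier) where

    ∑words-cong : ∀ {f g} → (∀ w → f w ≈ g w) → ∀ k → ∑words q k f ≈ ∑words q k g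
    ∑words-cong f≈g zero    = f≈g []
    ∑words-cong f≈g (suc k) = +-cong (∑words-cong (f≈g ∘ (G ∷_)) k) (∑words-cong (f≈g ∘ (B ∷_)) k)

    ∑words-* : ∀ x f k → ∑words q k (λ w → x * f w) ≈ x * ∑words q k f
    ∑words-* x f zero    = refl
    ∑words-* x f (suc k) = trans (+-cong (∑words-* x _ k) (∑words-* x _ k)) (sym (distribˡ x _ _))

    ∑<-cong : ∀ {s t} → (∀ k → s k ≈ t k) → ∀ K → ∑< q K s ≈ ∑< q K t
    ∑<-cong s≈t zero    = refl
    ∑<-cong s≈t (suc K) = +-cong (∑<-cong s≈t K) (s≈t K)

    ∑<-linear : ∀ x y s t K → ∑< q K (λ k → x * s k + y * t k) ≈ x * ∑< q K s + y * ∑< q K t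
    ∑<-linear x y s t zero    = solve 2 (λ x y → con (+ 0) := x :* con (+ 0) :+ y :* con (+ 0)) x y
    ∑<-linear x y s t (suc K) = trans (+-congʳ (∑<-linear x y s t K))
      (solve 6 (λ x y S T s t → x :* S :+ y :* T :+ (x :* s :+ y :* t) :=
        x :* (S :+ s) :+ y :* (T :+ t)) x y _ _ (s K) (t K))

    ∑<-suc : ∀ s K → ∑< q (suc K) s ≈ s 0 + ∑< q K (s ∘ suc)
    ∑<-suc s zero    = +-comm 0# (s 0)
    ∑<-suc s (suc K) = trans (+-congʳ (∑<-suc s K)) (+-assoc _ _ _)

    partial : (ℕ → Carrier) → (List Team → Maybe ℕ) → ℕ → Carrier
    partial f φ K = ∑< q K λ k → ∑words q k λ w → probability q w * maybe′ f 0# (φ w)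

    -- The recursion is exact for truncated series and lowers the cutoff by one, so truncation
    -- errors can be estimated by induction on the cutoff.
    partial-suc : ∀ f φ K → partial f φ (suc K) ≈
      maybe′ f 0# (φ []) + ((1# - q) * partial f (φ ∘ (G ∷_)) K + q * partial f (φ ∘ (B ∷_)) K)
    partial-suc f φ K =
      trans (∑<-suc _ K) (+-cong (*-identityˡ _) (trans (∑<-cong step K) (∑<-linear (1# - q) q _ _ K)))
      where
      step : ∀ k → _ ≈ _
      step k = +-cong
        (trans (∑words-cong (λ w → *-assoc (1# - q) _ _) k) (∑words-* (1# - q) _ k))
        (trans (∑words-cong (λ w → *-assoc q _ _) k) (∑words-* q _ k))

    partial-0 : ∀ f φ → (∀ w → φ w ≡ nothing) → ∀ K → partial f φ K ≈ 0#
    partial-0 f φ φ≡nothing zero    = refl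
    partial-0 f φ φ≡nothing (suc K) = begin
      partial f φ (suc K)             ≈⟨ partial-suc f φ K ⟩
      maybe′ f 0# (φ []) + ((1# - q) * partial f (φ ∘ (G ∷_)) K + q * partial f (φ ∘ (B ∷_)) K)
                                      ≈⟨ +-cong (reflexive (≡.cong (maybe′ f 0#) (φ≡nothing [])))
                                           (+-cong (*-congˡ (partial-0 f _ (φ≡nothing ∘ (G ∷_)) K))
                                                   (*-congˡ (partial-0 f _ (φ≡nothing ∘ (B ∷_)) K))) ⟩
      0# + ((1# - q) * 0# + q * 0#)
        ≈⟨ solve 1 (λ q → con (+ 0) :+ ((con (+ 1) :- q) :* con (+ 0) :+ q :* con (+ 0)) := con (+ 0)) q ⟩
      0#                              ∎
      where open SetoidReasoning setoid

    -- A goal of Phase II is charged to the integrand, so that the rest of the play again starts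
    -- from duration 0.
    partial-tick : ∀ f φ ψ → (∀ w → φ w ≡ Maybe.map suc (ψ w)) → ∀ K → partial f φ K ≈ partial (f ∘ suc) ψ K
    partial-tick f φ ψ tick K = ∑<-cong (λ k → ∑words-cong (λ w → *-congˡ (reflexive
      (≡.trans (≡.cong (maybe′ f 0#) (tick w)) (maybe′-map-suc (ψ w))))) k) K
      where
      maybe′-map-suc : ∀ m → maybe′ f 0# (Maybe.map suc m) ≡ maybe′ (f ∘ suc) 0# m
      maybe′-map-suc (just _) = ≡.refl
      maybe′-map-suc nothing  = ≡.refl

    -- Only the empty play contributes; it is counted as soon as the cutoff is positive.
    phaseII-over : ∀ f {g b} → g ℕ.≤ b → ∀ K → partial f (phaseII g b) (suc K) ≈ f 0
    phaseII-over f {g} {b} g≤b K = begin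
      partial f (phaseII g b) (suc K)  ≈⟨ partial-suc f (phaseII g b) K ⟩
      maybe′ f 0# (phaseII g b [])
        + ((1# - q) * partial f (phaseII g b ∘ (G ∷_)) K + q * partial f (phaseII g b ∘ (B ∷_)) K)
        ≈⟨ +-cong (reflexive (≡.cong (maybe′ f 0#) won))
                  (+-cong (*-congˡ (partial-0 f _ over-G K)) (*-congˡ (partial-0 f _ over-B K))) ⟩
      f 0 + ((1# - q) * 0# + q * 0#)
        ≈⟨ solve 2 (λ x q → x :+ ((con (+ 1) :- q) :* con (+ 0) :+ q :* con (+ 0)) := x) (f 0) q ⟩
      f 0                              ∎
      where
      open SetoidReasoning setoid
      won : phaseII g b [] ≡ just 0
      won rewrite ≤ᵇ-true g≤b = ≡.refl
      over-G : ∀ w → phaseII g b (G ∷ w) ≡ nothing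
      over-G w rewrite ≤ᵇ-true g≤b = ≡.refl
      over-B : ∀ w → phaseII g b (B ∷ w) ≡ nothing
      over-B w rewrite ≤ᵇ-true g≤b = ≡.refl

    phaseII-suc : ∀ f {g b} → b ℕ.< g → ∀ K → partial f (phaseII g b) (suc K) ≈
      (1# - q) * partial (f ∘ suc) (phaseII (suc g) b) K + q * partial (f ∘ suc) (phaseII g (suc b)) K
    phaseII-suc f {g} {b} b<g K = begin
      partial f (phaseII g b) (suc K)  ≈⟨ partial-suc f (phaseII g b) K ⟩
      maybe′ f 0# (phaseII g b [])
        + ((1# - q) * partial f (phaseII g b ∘ (G ∷_)) K + q * partial f (phaseII g b ∘ (B ∷_)) K)
        ≈⟨ +-cong (reflexive (≡.cong (maybe′ f 0#) undecided))
                  (+-cong (*-congˡ (partial-tick f _ (phaseII (suc g) b) after-G K))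
                          (*-congˡ (partial-tick f _ (phaseII g (suc b)) after-B K))) ⟩
      0# + ((1# - q) * partial (f ∘ suc) (phaseII (suc g) b) K + q * partial (f ∘ suc) (phaseII g (suc b)) K)
        ≈⟨ +-identityˡ _ ⟩
      (1# - q) * partial (f ∘ suc) (phaseII (suc g) b) K
        + q * partial (f ∘ suc) (phaseII g (suc b)) K         ∎
      where
      open SetoidReasoning setoid
      undecided : phaseII g b [] ≡ nothing
      undecided rewrite ≤ᵇ-false b<g = ≡.refl
      after-G : ∀ w → phaseII g b (G ∷ w) ≡ Maybe.map suc (phaseII (suc g) b w)
      after-G w rewrite ≤ᵇ-false b<g = ≡.refl
      after-B : ∀ w → phaseII g b (B ∷ w) ≡ Maybe.map suc (phaseII g (suc b) w)
      after-B w rewrite ≤ᵇ-false b<g = ≡.refl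

    phaseI-suc : ∀ f r g b K → partial f (phaseI (suc r) g b) (suc K) ≈
      (1# - q) * partial f (phaseI r (suc g) b) K + q * partial f (phaseI (suc r) g (suc b)) K
    phaseI-suc f r g b K = trans (partial-suc f (phaseI (suc r) g b) K) (+-identityˡ _)

-- Phase II: moments of the duration from a given gap

module ConditionalVariance {c ℓ₁ ℓ₂} (ℝ : Reals c ℓ₁ ℓ₂) where

  open TwoPhaseGame ℝ hiding (zero)
  open OrderedFieldProperties ℝ
  open Plays ℝ

  module _ (q : Carrier) (0<q : 0# < q) (q<½ : q < ½) where

    open PartialSums q

    private
      2# : Carrier
      2# = 1# + 1#

    p δ : Carrier
    p = 1# - q
    δ = 1# - 2# * q

    0≤q : 0# ≤ q
    0≤q = <⇒≤ 0<q

    0<δ : 0# < δ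
    0<δ = <-respʳ-≈ (solve 1 (λ q → con (+ 1) :- (q :+ q) := con (+ 1) :- con (+ 2) :* q) q)
      (x<y⇒0<y-x (<-respʳ-≈ ½+½≈1 (+-mono-< q<½ q<½)))

    0≤δ : 0# ≤ δ
    0≤δ = <⇒≤ 0<δ

    0<p : 0# < p
    0<p = <-respʳ-≈ (solve 1 (λ q → con (+ 1) :- con (+ 2) :* q :+ q := con (+ 1) :- q) q) (0<+ 0<δ 0≤q)

    0≤p : 0# ≤ p
    0≤p = <⇒≤ 0<p

    p⁻¹ q⁻¹ D : Carrier
    p⁻¹ = 0<x⇒x#0 0<p ⁻¹
    q⁻¹ = 0<x⇒x#0 0<q ⁻¹
    D   = 0<x⇒x#0 0<δ ⁻¹

    p*p⁻¹≈1 : p * p⁻¹ ≈ 1#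
    p*p⁻¹≈1 = ⁻¹-inverse (0<x⇒x#0 0<p)

    q*q⁻¹≈1 : q * q⁻¹ ≈ 1#
    q*q⁻¹≈1 = ⁻¹-inverse (0<x⇒x#0 0<q)

    δ*D≈1 : δ * D ≈ 1#
    δ*D≈1 = ⁻¹-inverse (0<x⇒x#0 0<δ)

    0≤D : 0# ≤ D
    0≤D = <⇒≤ (0<⁻¹ 0<δ)

    ρ κ : Carrier
    ρ = q * p⁻¹
    κ = p * q⁻¹

    0≤ρ : 0# ≤ ρ
    0≤ρ = 0≤* 0≤q (<⇒≤ (0<⁻¹ 0<p))

    0≤1-δ : 0# ≤ 1# - δ
    0≤1-δ = ≤-respʳ (solve 1 (λ q → q :+ q := con (+ 1) :- (con (+ 1) :- con (+ 2) :* q)) q) (0≤+ 0≤q 0≤q)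

    δ≤1 : δ ≤ 1#
    δ≤1 = ≤-by (1# - δ) 0≤1-δ (solve 1 (λ d → d :+ (con (+ 1) :- d) := con (+ 1)) δ)

    q≤1 : q ≤ 1#
    q≤1 = ≤-by p 0≤p (solve 1 (λ q → q :+ (con (+ 1) :- q) := con (+ 1)) q)

    2q≤1 : 2# * q ≤ 1#
    2q≤1 = ≤-by δ 0≤δ (solve 1 (λ q → con (+ 2) :* q :+ (con (+ 1) :- con (+ 2) :* q) := con (+ 1)) q)

    *≤1 : ∀ {x y} → 0# ≤ x → x ≤ 1# → 0# ≤ y → y ≤ 1# → x * y ≤ 1#
    *≤1 0≤x x≤1 0≤y y≤1 = ≤-respʳ (*-identityˡ 1#) (*-mono-≤ 0≤x x≤1 0≤y y≤1)

    -- Quadratic integrands are closed under d ↦ d + 1 and include those of the probability, the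
    -- mean and the variance, so one computation serves all three.
    quad : Carrier → Carrier → Carrier → ℕ → Carrier
    quad α β γ d = α + β * (d · 1#) + γ * (d · 1# * (d · 1#))

    -- From a gap i, B catches up with probability ρⁱ, and given this the duration has mean i / δ and
    -- variance 4pq i / δ³.
    value : Carrier → Carrier → Carrier → ℕ → Carrier
    value α β γ i =
      ρ ^ i * (α + β * (i · 1# * D)
        + γ * (i · 1# * (i · 1#) * (D * D) + (2# + 2#) * p * q * (i · 1#) * (D * D * D)))

    -- First-step analysis: the gap moves up with probability p and down with probability q.
    value-suc : ∀ α β γ i → value α β γ (suc i) ≈
      p * value (α + β + γ) (β + 2# * γ) γ (suc (suc i)) + q * value (α + β + γ) (β + 2# * γ) γ i
    value-suc α β γ i = sym (begin
      p * (ρ * (ρ * r) * H (1# + (1# + t))) + q * (r * H t)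
        ≈⟨ modulo (ρ * r * q * H (1# + (1# + t)) - q * r * H t) p*p⁻¹≈1
            (solve 7 (λ p q p⁻¹ r H H₂ H₀ → let ρ = q :* p⁻¹ in
              p :* (ρ :* (ρ :* r) :* H₂) :+ q :* (r :* H₀) :=
              ρ :* r :* (q :* H₂ :+ p :* H₀)
                :+ (p :* p⁻¹ :- con (+ 1)) :* (ρ :* r :* q :* H₂ :- q :* r :* H₀))
              p q p⁻¹ r 0# (H (1# + (1# + t))) (H t)) ⟩
      ρ * r * (q * H (1# + (1# + t)) + p * H t)
        ≈⟨ *-congˡ (modulo (- (β + γ * (2# * (1# + t) * D + D * D + 1# - δ * D - δ * D * (δ * D)))) δ*D≈1
            (solve 6 (λ q D α β γ t →
              let p = con (+ 1) :- q
                  δ = con (+ 1) :- con (+ 2) :* q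
                  H = λ α β γ t → α :+ β :* (t :* D)
                    :+ γ :* (t :* t :* (D :* D) :+ (con (+ 2) :+ con (+ 2)) :* p :* q :* t :* (D :* D :* D))
                  H′ = H (α :+ β :+ γ) (β :+ con (+ 2) :* γ) γ
              in q :* H′ (con (+ 1) :+ (con (+ 1) :+ t)) :+ p :* H′ t :=
                 H α β γ (con (+ 1) :+ t) :+ (δ :* D :- con (+ 1)) :*
                   :- (β :+ γ :* (con (+ 2) :* (con (+ 1) :+ t) :* D :+ D :* D :+ con (+ 1) :- δ :* D
                     :- δ :* D :* (δ :* D))))
              q D α β γ t)) ⟩
      ρ * r * (α + β * ((1# + t) * D)
        + γ * ((1# + t) * (1# + t) * (D * D) + (2# + 2#) * p * q * (1# + t) * (D * D * D))) ∎)
      where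
      open SetoidReasoning setoid
      t = i · 1#
      r = ρ ^ i
      H : Carrier → Carrier
      H t = α + β + γ + (β + 2# * γ) * (t * D) + γ * (t * t * (D * D) + (2# + 2#) * p * q * t * (D * D * D))

    -- The weights ε and η are chosen so small that the error below still contracts when the shift
    -- d ↦ d + 1 has multiplied the coefficients by up to ζ.
    η ε ζ X θ Λ : Carrier
    η = δ * (q * q)
    ε = η * (δ * δ * δ)
    ζ = 1# + 2# * ε
    X = ½ * p⁻¹
    θ = ½ + 2# * p * q
    Λ = ζ * θ

    0≤η : 0# ≤ η
    0≤η = 0≤* 0≤δ (0≤* 0≤q 0≤q)

    0≤ε : 0# ≤ ε
    0≤ε = 0≤* 0≤η (0≤* (0≤* 0≤δ 0≤δ) 0≤δ)

    0≤X : 0# ≤ X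
    0≤X = 0≤* (<⇒≤ 0<½) (<⇒≤ (0<⁻¹ 0<p))

    0≤2 : 0# ≤ 2#
    0≤2 = 0≤+ 0≤1 0≤1

    0≤θ : 0# ≤ θ
    0≤θ = 0≤+ (<⇒≤ 0<½) (0≤* (0≤* 0≤2 0≤p) 0≤q)

    0≤ζ : 0# ≤ ζ
    0≤ζ = 0≤+ 0≤1 (0≤* 0≤2 0≤ε)

    0≤Λ : 0# ≤ Λ
    0≤Λ = 0≤* 0≤ζ 0≤θ

    η≤1 : η ≤ 1#
    η≤1 = *≤1 0≤δ δ≤1 (0≤* 0≤q 0≤q) (*≤1 0≤q q≤1 0≤q q≤1)

    ε≤1 : ε ≤ 1#
    ε≤1 = *≤1 0≤η η≤1 (0≤* (0≤* 0≤δ 0≤δ) 0≤δ) (*≤1 (0≤* 0≤δ 0≤δ) (*≤1 0≤δ δ≤1 0≤δ δ≤1) 0≤δ δ≤1)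

    θ≤1 : θ ≤ 1#
    θ≤1 = ≤-by (½ * (δ * δ)) (0≤* (<⇒≤ 0<½) (0≤* 0≤δ 0≤δ)) (modulo (1# - 2# * q + 2# * q * q) ½+½≈1
      (solve 2 (λ q h → h :+ con (+ 2) :* (con (+ 1) :- q) :* q
        :+ h :* ((con (+ 1) :- con (+ 2) :* q) :* (con (+ 1) :- con (+ 2) :* q)) :=
        con (+ 1) :+ (h :+ h :- con (+ 1)) :* (con (+ 1) :- con (+ 2) :* q :+ con (+ 2) :* q :* q)) q ½))

    -- Here θ = 1 - δ²/2 and ε = δ⁴q², so 1 - Λ = δ²(1/2 - qy) with y = 2δ²qθ at most 1; and q <
    -- 1/2.
    Λ<1 : Λ < 1#
    Λ<1 = <-by (δ * δ * ((½ - q) + q * (1# - y)))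
      (*-pos (*-pos 0<δ 0<δ) (0<+ (x<y⇒0<y-x q<½) (0≤* 0≤q (0≤y-x y≤1))))
      (modulo (1# - 2# * q + 2# * q * q) ½+½≈1
        (solve 2 (λ q h →
          let p = con (+ 1) :- q
              δ = con (+ 1) :- con (+ 2) :* q
              ε = δ :* (q :* q) :* (δ :* δ :* δ)
              θ = h :+ con (+ 2) :* p :* q
              y = δ :* δ :* (con (+ 2) :* q) :* θ
          in (con (+ 1) :+ con (+ 2) :* ε) :* θ :+ δ :* δ :* (h :- q :+ q :* (con (+ 1) :- y)) :=
             con (+ 1) :+ (h :+ h :- con (+ 1)) :* (con (+ 1) :- con (+ 2) :* q :+ con (+ 2) :* q :* q))
          q ½))
      where
      y = δ * δ * (2# * q) * θ
      0≤2q = 0≤* 0≤2 0≤q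
      0≤δδ = 0≤* 0≤δ 0≤δ
      y≤1 : y ≤ 1#
      y≤1 = *≤1 (0≤* 0≤δδ 0≤2q) (*≤1 0≤δδ (*≤1 0≤δ δ≤1 0≤δ δ≤1) 0≤2q 2q≤1) 0≤θ θ≤1

    -- The factor (1 + η)² per unit of gap pays for the terms i and i² in `value`, which are not
    -- bounded by a multiple of ρⁱ.
    [1+η]²ρ≤X : (1# + η) * (1# + η) * ρ ≤ X
    [1+η]²ρ≤X = ≤-by (½ * p⁻¹ * s)
      (0≤* 0≤X (0≤+ (0≤* 0≤δ 0≤δ)
        (0≤* (0≤* (0≤* 0≤2 0≤q) 0≤δ) (0≤+ (0≤* 0≤δ (0≤y-x q⁴≤1)) (0≤* (0≤* 0≤2 0≤q) 0≤p)))))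
      (modulo (p⁻¹ * (- (1# + η) * (1# + η) * q)) ½+½≈1
        (solve 3 (λ q h P →
          let p = con (+ 1) :- q
              δ = con (+ 1) :- con (+ 2) :* q
              η = δ :* (q :* q)
              s = δ :* δ
                :+ con (+ 2) :* q :* δ :* (δ :* (con (+ 1) :- q :* q :* (q :* q)) :+ con (+ 2) :* q :* p)
          in (con (+ 1) :+ η) :* (con (+ 1) :+ η) :* (q :* P) :+ h :* P :* s :=
             h :* P :+ (h :+ h :- con (+ 1)) :* (P :* (:- (con (+ 1) :+ η) :* (con (+ 1) :+ η) :* q)))
          q ½ p⁻¹))
      where
      s = δ * δ + 2# * q * δ * (δ * (1# - q * q * (q * q)) + 2# * q * p)
      0≤qq = 0≤* 0≤q 0≤q
      qq≤1 = *≤1 0≤q q≤1 0≤q q≤1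
      q⁴≤1 : q * q * (q * q) ≤ 1#
      q⁴≤1 = *≤1 0≤qq qq≤1 0≤qq qq≤1

    -- A weighted maximum norm: the shift d ↦ d + 1 adds higher coefficients to lower ones, and the
    -- powers of ε limit the growth this causes to the factor ζ.
    Small : Carrier → Carrier → Carrier → Carrier → Set _
    Small N α β γ = ∣ α ∣≤ N × ∣ β ∣≤ ε * N × ∣ γ ∣≤ ε * (ε * N)

    Small⇒0≤ : ∀ {N α β γ} → Small N α β γ → 0# ≤ N
    Small⇒0≤ (α≤ , _) = ∣∣≤⇒0≤ α≤

    Small-shift : ∀ {N α β γ} → Small N α β γ → Small (N * ζ) (α + β + γ) (β + 2# * γ) γ
    Small-shift {N} {α} {β} {γ} small@(α≤ , β≤ , γ≤) =
      ∣∣≤-weaken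
        (≤-by (ε * (N * (1# - ε))) (0≤* 0≤ε (0≤* 0≤N (0≤y-x ε≤1)))
          (solve 2 (λ N ε → N :+ ε :* N :+ ε :* (ε :* N) :+ ε :* (N :* (con (+ 1) :- ε)) :=
            N :* (con (+ 1) :+ con (+ 2) :* ε)) N ε))
        (∣∣≤-+ (∣∣≤-+ α≤ β≤) γ≤) ,
      ∣∣≤-weaken (≤-reflexive
        (solve 2 (λ N ε → ε :* N :+ con (+ 2) :* (ε :* (ε :* N)) :=
          ε :* (N :* (con (+ 1) :+ con (+ 2) :* ε))) N ε))
        (∣∣≤-+ β≤ (∣∣≤-* (0≤⇒∣∣≤ 0≤2 ≤-refl) γ≤)) ,
      ∣∣≤-weaken
        (≤-by (ε * (ε * (N * (2# * ε)))) (0≤* 0≤ε (0≤* 0≤ε (0≤* 0≤N (0≤* 0≤2 0≤ε))))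
          (solve 2 (λ N ε → ε :* (ε :* N) :+ ε :* (ε :* (N :* (con (+ 2) :* ε))) :=
            ε :* (ε :* (N :* (con (+ 1) :+ con (+ 2) :* ε)))) N ε))
        γ≤
      where
      0≤N : 0# ≤ N
      0≤N = Small⇒0≤ small

    quad-shift : ∀ α β γ d → quad α β γ (suc d) ≈ quad (α + β + γ) (β + 2# * γ) γ d
    quad-shift α β γ d =
      solve 4 (λ α β γ t → α :+ β :* (con (+ 1) :+ t) :+ γ :* ((con (+ 1) :+ t) :* (con (+ 1) :+ t)) :=
      α :+ β :+ γ :+ (β :+ con (+ 2) :* γ) :* t :+ γ :* (t :* t)) α β γ (d · 1#)

    bernoulli : ∀ i → 1# + η * (i · 1#) ≤ (1# + η) ^ i
    bernoulli zero    = ≤-reflexive (solve 1 (λ η → con (+ 1) :+ η :* con (+ 0) := con (+ 1)) η)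
    bernoulli (suc i) = ≤-trans
      (≤-by (η * η * (i · 1#)) (0≤* (0≤* 0≤η 0≤η) (0≤n·1 i))
        (solve 2 (λ η t → con (+ 1) :+ η :* (con (+ 1) :+ t) :+ η :* η :* t :=
          (con (+ 1) :+ η) :* (con (+ 1) :+ η :* t)) η (i · 1#)))
      (*-monoʳ-≤ (0≤+ 0≤1 0≤η) (bernoulli i))

    -- The factor δ³ in ε outweighs the denominators D, so the bracket in `value` is at most N(1 +
    -- ηi)². Bernoulli's inequality bounds this by N(1 + η)²ⁱ, which X absorbs together with ρⁱ.
    value-small : ∀ {N α β γ} → Small N α β γ → ∀ i → ∣ value α β γ i ∣≤ N * X ^ i
    value-small {N} {α} {β} {γ} small@(α≤ , β≤ , γ≤) i = ∣∣≤-weaken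
      (≤-trans (*-monoʳ-≤ (0≤^ 0≤ρ i) square) geometric)
      (∣∣≤-* (0≤⇒∣∣≤ (0≤^ 0≤ρ i) ≤-refl)
        (∣∣≤-+ (∣∣≤-+ α≤ (∣∣≤-* β≤ (0≤⇒∣∣≤ (0≤* 0≤t 0≤D) ≤-refl)))
          (∣∣≤-* γ≤ (0≤⇒∣∣≤
            (0≤+ (0≤* (0≤* 0≤t 0≤t) (0≤* 0≤D 0≤D)) (0≤* (0≤* 0≤4pq 0≤t) (0≤* (0≤* 0≤D 0≤D) 0≤D))) ≤-refl))))
      where
      open SetoidReasoning setoid
      t = i · 1#
      4pq = (2# + 2#) * p * q
      0≤N = Small⇒0≤ small
      0≤t = 0≤n·1 i
      0≤δδ = 0≤* 0≤δ 0≤δ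
      0≤4pq : 0# ≤ 4pq
      0≤4pq = 0≤* (0≤* (0≤+ 0≤2 0≤2) 0≤p) 0≤q
      δδ≤1 : δ * δ ≤ 1#
      δδ≤1 = *≤1 0≤δ δ≤1 0≤δ δ≤1
      4pq≤1 : 4pq ≤ 1#
      4pq≤1 = ≤-by (δ * δ) 0≤δδ (solve 1 (λ q → let δ = con (+ 1) :- con (+ 2) :* q in
        (con (+ 2) :+ con (+ 2)) :* (con (+ 1) :- q) :* q :+ δ :* δ := con (+ 1)) q)
      4pqη≤1 : 4pq * η ≤ 1#
      4pqη≤1 = *≤1 0≤4pq 4pq≤1 0≤η η≤1
      4pqηδ³≤1 : 4pq * η * (δ * δ * δ) ≤ 1#
      4pqηδ³≤1 = *≤1 (0≤* 0≤4pq 0≤η) 4pqη≤1 (0≤* 0≤δδ 0≤δ) (*≤1 0≤δδ δδ≤1 0≤δ δ≤1)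
      a = 1# - δ * δ
      b = 1# - 4pq * η * (δ * δ * δ)
      e = 1# - δ * δ * (δ * δ)
      square : N + ε * N * (t * D)
        + ε * (ε * N) * (t * t * (D * D) + 4pq * t * (D * D * D)) ≤ N * ((1# + η * t) * (1# + η * t))
      square = ≤-by (N * (η * t * (a + b) + η * t * (η * t) * e))
        (0≤* 0≤N (0≤+ (0≤* (0≤* 0≤η 0≤t) (0≤+ (0≤y-x δδ≤1) (0≤y-x 4pqηδ³≤1)))
          (0≤* (0≤* (0≤* 0≤η 0≤t) (0≤* 0≤η 0≤t)) (0≤y-x (*≤1 0≤δδ δδ≤1 0≤δδ δδ≤1)))))
        (modulo
          (N * (η * (δ * δ) * t + η * η * (δ * δ * (δ * δ)) * (t * t) * (δ * D + 1#)
            + 4pq * (η * η) * (δ * δ * δ) * t * (δ * D * (δ * D) + δ * D + 1#))) δ*D≈1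
          (solve 6 (λ N η δ D t 4pq →
            let ε = η :* (δ :* δ :* δ)
                u = δ :* D
            in N :+ ε :* N :* (t :* D) :+ ε :* (ε :* N) :* (t :* t :* (D :* D) :+ 4pq :* t :* (D :* D :* D))
                 :+ N :* (η :* t :* (con (+ 1) :- δ :* δ :+ (con (+ 1) :- 4pq :* η :* (δ :* δ :* δ)))
                      :+ η :* t :* (η :* t) :* (con (+ 1) :- δ :* δ :* (δ :* δ))) :=
               N :* ((con (+ 1) :+ η :* t) :* (con (+ 1) :+ η :* t)) :+ (u :- con (+ 1)) :*
                 (N :* (η :* (δ :* δ) :* t :+ η :* η :* (δ :* δ :* (δ :* δ)) :* (t :* t) :* (u :+ con (+ 1))
                   :+ 4pq :* (η :* η) :* (δ :* δ :* δ) :* t :* (u :* u :+ u :+ con (+ 1)))))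
            N η δ D t 4pq))
      0≤1+ηt = 0≤+ 0≤1 (0≤* 0≤η 0≤t)
      0≤1+η = 0≤+ 0≤1 0≤η
      geometric : ρ ^ i * (N * ((1# + η * t) * (1# + η * t))) ≤ N * X ^ i
      geometric = ≤-respˡ (solve 3 (λ r N s → N :* (s :* r) := r :* (N :* s)) (ρ ^ i) N _)
        (*-monoʳ-≤ 0≤N (≤-trans
          (*-mono-≤ (0≤* 0≤1+ηt 0≤1+ηt) (*-mono-≤ 0≤1+ηt (bernoulli i) 0≤1+ηt (bernoulli i))
            (0≤^ 0≤ρ i) ≤-refl)
          (≤-respˡ (trans (^-distrib-* _ ρ i) (*-congʳ (^-distrib-* (1# + η) (1# + η) i)))
            (^-monoˡ-≤ (0≤* (0≤* 0≤1+η 0≤1+η) 0≤ρ) [1+η]²ρ≤X i))))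

    -- X = 1/(2p) lies strictly between the roots ρ and 1 of pX² - X + q. So Xⁱ is a strict
    -- supersolution of the first-step equation, with factor θ. The best factor would belong to the
    -- square root of q / p; this choice stays rational.
    pX²+q≈θX : p * (X * X) + q ≈ θ * X
    pX²+q≈θX = begin
      p * (½ * p⁻¹ * (½ * p⁻¹)) + q  ≈⟨ modulo (½ * (½ * p⁻¹) - q) p*p⁻¹≈1
        (solve 4 (λ p q h P → p :* (h :* P :* (h :* P)) :+ q :=
          h :* (h :* P) :+ q :* (p :* P) :+ (p :* P :- con (+ 1)) :* (h :* (h :* P) :- q)) p q ½ p⁻¹) ⟩
      ½ * (½ * p⁻¹) + q * (p * p⁻¹)  ≈⟨ modulo (- (p * q * p⁻¹)) ½+½≈1
        (solve 4 (λ p q h P → h :* (h :* P) :+ q :* (p :* P) :=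
          (h :+ con (+ 2) :* p :* q) :* (h :* P) :+ (h :+ h :- con (+ 1)) :* :- (p :* q :* P)) p q ½ p⁻¹) ⟩
      θ * X                          ∎
      where open SetoidReasoning setoid

    -- Induction on the cutoff. At cutoff 0 the series is empty and the error is `value` itself.
    -- Each goal costs a factor ζ, from shifting the integrand, and gains a factor θ, from averaging
    -- Xⁱ over the two neighbouring gaps.
    phaseII-error : ∀ K i b {f α β γ N} → (∀ d → f d ≈ quad α β γ d) → Small N α β γ →
      ∣ value α β γ i - partial f (phaseII (i ℕ.+ b) b) K ∣≤ N * Λ ^ K * X ^ i
    phaseII-error zero i b {N = N} f≈quad small = ∣∣≤-weaken
      (≤-reflexive (*-congʳ (sym (*-identityʳ N)))) (∣∣≤-resp (sym (x-0≈x _)) (value-small small i))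
    phaseII-error (suc K) zero b {f} {α} {β} {γ} {N} f≈quad small = ∣∣≤-resp (sym (begin
      value α β γ 0 - partial f (phaseII b b) (suc K)
        ≈⟨ +-cong refl (-‿cong (trans (phaseII-over f ℕ.≤-refl K) (f≈quad 0))) ⟩
      value α β γ 0 - quad α β γ 0                     ≈⟨ solve 6 (λ α β γ D p q →
        con (+ 1) :* (α :+ β :* (con (+ 0) :* D)
          :+ γ :* (con (+ 0) :* con (+ 0) :* (D :* D) :+ (con (+ 2) :+ con (+ 2)) :* p :* q :* con (+ 0) :* (D :* D :* D)))
          :- (α :+ β :* con (+ 0) :+ γ :* (con (+ 0) :* con (+ 0))) := con (+ 0)) α β γ D p q ⟩
      0#                                               ∎))
      (∣0∣≤ (0≤* (0≤* (Small⇒0≤ small) (0≤^ 0≤Λ (suc K))) 0≤1))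
      where open SetoidReasoning setoid
    phaseII-error (suc K) (suc i) b {f} {α} {β} {γ} {N} f≈quad small = ∣∣≤-resp (sym (begin
      value α β γ (suc i) - partial f (phaseII (suc i ℕ.+ b) b) (suc K)
        ≈⟨ +-cong (value-suc α β γ i) (-‿cong (phaseII-suc f (ℕ.s≤s (ℕ.m≤n+m b i)) K)) ⟩
      p * up + q * down
        - (p * partial (f ∘ suc) (phaseII (suc (suc i) ℕ.+ b) b) K
          + q * partial (f ∘ suc) (phaseII (suc i ℕ.+ b) (suc b)) K)
        ≈⟨ solve 6 (λ p q u d U W → p :* u :+ q :* d :- (p :* U :+ q :* W) :=
          p :* (u :- U) :+ q :* (d :- W)) p q up down _ _ ⟩
      p * (up - partial (f ∘ suc) (phaseII (suc (suc i) ℕ.+ b) b) K)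
        + q * (down - partial (f ∘ suc) (phaseII (suc i ℕ.+ b) (suc b)) K)
        ≡⟨ ≡.cong (λ g → p * (up - partial (f ∘ suc) (phaseII (suc (suc i) ℕ.+ b) b) K)
          + q * (down - partial (f ∘ suc) (phaseII g (suc b)) K)) (≡.sym (ℕ.+-suc i b)) ⟩
      p * (up - partial (f ∘ suc) (phaseII (suc (suc i) ℕ.+ b) b) K)
        + q * (down - partial (f ∘ suc) (phaseII (i ℕ.+ suc b) (suc b)) K) ∎))
      (∣∣≤-weaken (≤-reflexive (begin
        p * (N * ζ * L * (X * (X * x))) + q * (N * ζ * L * x)
          ≈⟨ solve 7 (λ p q N ζ L X x → p :* (N :* ζ :* L :* (X :* (X :* x))) :+ q :* (N :* ζ :* L :* x) :=
            N :* ζ :* L :* x :* (p :* (X :* X) :+ q)) p q N ζ L X x ⟩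
        N * ζ * L * x * (p * (X * X) + q)  ≈⟨ *-congˡ pX²+q≈θX ⟩
        N * ζ * L * x * (θ * X)
          ≈⟨ solve 6 (λ N ζ L x θ X → N :* ζ :* L :* x :* (θ :* X) :=
            N :* (ζ :* θ :* L) :* (X :* x)) N ζ L x θ X ⟩
        N * (Λ * L) * (X * x)              ∎))
        (∣∣≤-+ (∣∣≤-* (0≤⇒∣∣≤ 0≤p ≤-refl) (phaseII-error K (suc (suc i)) b f-shift (Small-shift small)))
               (∣∣≤-* (0≤⇒∣∣≤ 0≤q ≤-refl) (phaseII-error K i (suc b) f-shift (Small-shift small)))))
      where
      open SetoidReasoning setoid
      up   = value (α + β + γ) (β + 2# * γ) γ (suc (suc i))
      down = value (α + β + γ) (β + 2# * γ) γ i
      L = Λ ^ K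
      x = X ^ i
      f-shift : ∀ d → f (suc d) ≈ quad (α + β + γ) (β + 2# * γ) γ d
      f-shift d = trans (f≈quad (suc d)) (quad-shift α β γ d)

    0<ε : 0# < ε
    0<ε = *-pos (*-pos 0<δ (*-pos 0<q 0<q)) (*-pos (*-pos 0<δ 0<δ) 0<δ)

    Small-exists : ∀ α β γ → ∃[ N ] Small N α β γ
    Small-exists α β γ = N ,
      ∣∣≤-weaken (≤-by (i * (b + i * g)) (0≤* 0≤i (0≤+ 0≤b (0≤* 0≤i 0≤g))) refl) (proj₂ (bounded α)) ,
      ∣∣≤-weaken (≤-by (ε * a + ε * (i * (i * g))) (0≤+ (0≤* 0≤ε 0≤a) (0≤* 0≤ε (0≤* 0≤i (0≤* 0≤i 0≤g))))
        (sym (modulo b ε*i≈1 (solve 5 (λ a b g ε i → ε :* (a :+ i :* (b :+ i :* g)) :=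
          b :+ (ε :* a :+ ε :* (i :* (i :* g))) :+ (ε :* i :- con (+ 1)) :* b) a b g ε i))))
        (proj₂ (bounded β)) ,
      ∣∣≤-weaken (≤-by (ε * (ε * a) + ε * (ε * (i * b)))
        (0≤+ (0≤* 0≤ε (0≤* 0≤ε 0≤a)) (0≤* 0≤ε (0≤* 0≤ε (0≤* 0≤i 0≤b))))
        (sym (modulo ((ε * i + 1#) * g) ε*i≈1 (solve 5 (λ a b g ε i → ε :* (ε :* (a :+ i :* (b :+ i :* g))) :=
          g :+ (ε :* (ε :* a) :+ ε :* (ε :* (i :* b)))
            :+ (ε :* i :- con (+ 1)) :* ((ε :* i :+ con (+ 1)) :* g)) a b g ε i))))
        (proj₂ (bounded γ))
      where
      a = proj₁ (bounded α)
      b = proj₁ (bounded β)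
      g = proj₁ (bounded γ)
      0≤a = ∣∣≤⇒0≤ (proj₂ (bounded α))
      0≤b = ∣∣≤⇒0≤ (proj₂ (bounded β))
      0≤g = ∣∣≤⇒0≤ (proj₂ (bounded γ))
      i = 0<x⇒x#0 0<ε ⁻¹
      0≤i = <⇒≤ (0<⁻¹ 0<ε)
      ε*i≈1 = ⁻¹-inverse (0<x⇒x#0 0<ε)
      -- The sum a + b/ε + g/ε² serves as an upper bound of its three summands, in place of their
      -- maximum.
      N = a + i * (b + i * g)

    phaseII-limit : ∀ {f α β γ} → (∀ d → f d ≈ quad α β γ d) → ∀ i b →
      partial f (phaseII (i ℕ.+ b) b) ⟶ value α β γ i
    phaseII-limit {f} {α} {β} {γ} f≈quad i b = limit (Small-exists α β γ)
      where
      limit : ∃[ N ] Small N α β γ → partial f (phaseII (i ℕ.+ b) b) ⟶ value α β γ i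
      limit (N , small) =
        ⟶-geometric {l = value α β γ i} {s = partial f (phaseII (i ℕ.+ b) b)} {θ = Λ} {C =
          N * X ^ i} 0≤Λ Λ<1 λ K → ∣∣≤-weaken
        (≤-reflexive (solve 3 (λ N L x → N :* L :* x := N :* x :* L) N (Λ ^ K) (X ^ i)))
        (phaseII-error K i b f≈quad small)

    -- Phase I: convergence of the series

    Θ : Carrier
    Θ = ½ + ½ * q

    0≤Θ : 0# ≤ Θ
    0≤Θ = 0≤+ (<⇒≤ 0<½) (0≤* (<⇒≤ 0<½) 0≤q)

    Θ<1 : Θ < 1#
    Θ<1 = <-by (½ * p) (*-pos 0<½ 0<p)
      (trans (solve 2 (λ h q → h :+ h :* q :+ h :* (con (+ 1) :- q) := h :+ h) ½ q) ½+½≈1)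

    -- B has already won and only the remaining `r` goals of G are awaited. The weight 2ʳ makes the
    -- expected factor per goal p/2 + q = Θ < 1.
    phaseI-won-error : ∀ f {N} → ∣ f 0 ∣≤ N → ∀ K r g b → r ℕ.+ g ℕ.≤ b →
      ∣ f 0 - partial f (phaseI r g b) K ∣≤ N * 2# ^ r * Θ ^ K
    phaseI-won-error f {N} f0≤N zero r g b _ = ∣∣≤-resp (sym (x-0≈x (f 0))) (∣∣≤-weaken
      (≤-respˡ (*-identityʳ N) (≤-respʳ (sym (*-identityʳ _)) (*-monoʳ-≤ (∣∣≤⇒0≤ f0≤N)
        (≤-respˡ (1^≈1 r) (^-monoˡ-≤ 0≤1 (≤-by 1# 0≤1 refl) r))))) f0≤N)
    phaseI-won-error f {N} f0≤N (suc K) zero g b g≤b = ∣∣≤-resp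
      (sym (trans (+-congˡ (-‿cong (phaseII-over f g≤b K))) (-‿inverseʳ (f 0))))
      (∣0∣≤ (0≤* (0≤* (∣∣≤⇒0≤ f0≤N) 0≤1) (0≤^ 0≤Θ (suc K))))
    phaseI-won-error f {N} f0≤N (suc K) (suc r) g b n≤b = ∣∣≤-resp
      (sym (trans (+-congˡ (-‿cong (phaseI-suc f r g b K)))
        (solve 4 (λ x q U W → x :- ((con (+ 1) :- q) :* U :+ q :* W) :=
          (con (+ 1) :- q) :* (x :- U) :+ q :* (x :- W)) (f 0) q _ _)))
      (∣∣≤-weaken (≤-reflexive (modulo (- (N * 2# ^ r * Θ ^ K * (1# + q))) ½+½≈1
          (solve 5 (λ N t q h L → (con (+ 1) :- q) :* (N :* t :* L) :+ q :* (N :* (con (+ 2) :* t) :* L) :=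
            N :* (con (+ 2) :* t) :* ((h :+ h :* q) :* L)
              :+ (h :+ h :- con (+ 1)) :* :- (N :* t :* L :* (con (+ 1) :+ q)))
            N (2# ^ r) q ½ (Θ ^ K))))
        (∣∣≤-+ (∣∣≤-* (0≤⇒∣∣≤ 0≤p ≤-refl)
          (phaseI-won-error f f0≤N K r (suc g) b (≡.subst (ℕ._≤ b) (≡.sym (ℕ.+-suc r g)) n≤b)))
               (∣∣≤-* (0≤⇒∣∣≤ 0≤q ≤-refl) (phaseI-won-error f f0≤N K (suc r) g (suc b) (ℕ.m≤n⇒m≤1+n n≤b)))))

    phaseI-won-limit : ∀ f r g b → r ℕ.+ g ℕ.≤ b → partial f (phaseI r g b) ⟶ f 0
    phaseI-won-limit f r g b n≤b =
      ⟶-geometric {l = f 0} {s = partial f (phaseI r g b)} {θ = Θ} {C = proj₁ (bounded (f 0)) * 2# ^ r}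
      0≤Θ Θ<1 λ K → phaseI-won-error f (proj₂ (bounded (f 0))) K r g b n≤b

    module _ {f : ℕ → Carrier} {α β γ : Carrier} (f≈quad : ∀ d → f d ≈ quad α β γ d) (Y : ℕ → ℕ → Carrier)
      (Y-zeroˡ : ∀ j → Y 0 j ≈ value α β γ j)
      (Y-zeroʳ : ∀ r → Y (suc r) 0 ≈ α)
      (Y-suc : ∀ r j → Y (suc r) (suc j) ≈ p * Y r (suc j) + q * Y (suc r) j)
      where

      -- Both sides of the equation are n, so `j` counts the goals B needs to reach n. Off the
      -- boundary each step lowers r + j, so this is a finite recursion and linearity of limits
      -- suffices; rates are needed only at r = 0 and j = 0.
      phaseI-limit : ∀ r j {g b} → r ℕ.+ g ≡ j ℕ.+ b → partial f (phaseI r g b) ⟶ Y r j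
      phaseI-limit zero j {b = b} ≡.refl =
        ⟶-resp (λ _ → refl) (sym (Y-zeroˡ j)) (phaseII-limit f≈quad j b)
      phaseI-limit (suc r) zero {g} {b} n≡b = ⟶-resp (λ _ → refl)
        (trans (f≈quad 0) (trans
          (solve 3 (λ α β γ → α :+ β :* con (+ 0) :+ γ :* (con (+ 0) :* con (+ 0)) := α) α β γ)
            (sym (Y-zeroʳ r))))
        (phaseI-won-limit f (suc r) g b (ℕ.≤-reflexive n≡b))
      phaseI-limit (suc r) (suc j) {g} {b} eq =
        ⟶-suc (⟶-resp (λ K → sym (phaseI-suc f r g b K)) (sym (Y-suc r j))
        (⟶-+ (⟶-* p (phaseI-limit r (suc j) (≡.trans (ℕ.+-suc r g) eq)))
             (⟶-* q (phaseI-limit (suc r) j (≡.trans eq (≡.sym (ℕ.+-suc j b)))))))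

    -- Phase I: closed forms

    -- score r j is the probability that exactly r of r + j goals are scored by G.
    score : ℕ → ℕ → Carrier
    score zero    zero    = 1#
    score zero    (suc j) = q * score zero j
    score (suc r) zero    = p * score r zero
    score (suc r) (suc j) = p * score r (suc j) + q * score (suc r) j

    -- race r j is the probability that B scores j further goals before G scores r.
    -- The value at r = j = 0 is a convention that keeps phaseI-value-zeroˡ true at j = 0.
    race : ℕ → ℕ → Carrier
    race zero    zero    = ½
    race zero    (suc j) = 0#
    race (suc r) zero    = 1#
    race (suc r) (suc j) = p * race r (suc j) + q * race (suc r) j

    mutual

      -- `score r j` is C(r + j, r) pʳqʲ. The two absorption identities follow from Pascal's rule,
      -- each using the other, without introducing binomial coefficients.
      score-sucˡ : ∀ r j → (suc r · 1#) * score (suc r) j ≈ (1# + r · 1# + j · 1#) * (p * score r j)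
      score-sucˡ r zero    = *-congʳ (sym (+-identityʳ _))
      score-sucˡ r (suc j) = modulo₂ q (- p) (score-sucˡ r j) (score-sucʳ r j)
        (solve 7 (λ r j p q s₀ s₁ s₂ → let 1+ = λ x → con (+ 1) :+ x in
          1+ r :* (p :* s₁ :+ q :* s₂) := (1+ r :+ 1+ j) :* (p :* s₁)
            :+ ((1+ r :* s₂ :- (1+ r :+ j) :* (p :* s₀)) :* q
              :+ (1+ j :* s₁ :- (1+ r :+ j) :* (q :* s₀)) :* :- p))
          (r · 1#) (j · 1#) p q (score r j) (score r (suc j)) (score (suc r) j))

      score-sucʳ : ∀ r j → (suc j · 1#) * score r (suc j) ≈ (1# + r · 1# + j · 1#) * (q * score r j)
      score-sucʳ zero    j = *-congʳ (+-congʳ (sym (+-identityʳ 1#)))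
      score-sucʳ (suc r) j = modulo₂ (- q) p (score-sucˡ r j) (score-sucʳ r j)
        (solve 7 (λ r j p q s₀ s₁ s₂ → let 1+ = λ x → con (+ 1) :+ x in
          1+ j :* (p :* s₁ :+ q :* s₂) := (1+ (1+ r) :+ j) :* (q :* s₂)
            :+ ((1+ r :* s₂ :- (1+ r :+ j) :* (p :* s₀)) :* :- q
              :+ (1+ j :* s₁ :- (1+ r :+ j) :* (q :* s₀)) :* p))
          (r · 1#) (j · 1#) p q (score r j) (score r (suc j)) (score (suc r) j))

    -- After r + j goals, only the score (r , j) distinguishes the two races.
    race-swap : ∀ r j → race (suc r) j ≈ race r (suc j) + score r j
    race-swap zero    zero    = sym (+-identityˡ 1#)
    race-swap zero    (suc j) = trans (+-congˡ (*-congˡ (race-swap zero j)))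
      (solve 3 (λ p q s → p :* con (+ 0) :+ q :* (con (+ 0) :+ s) := con (+ 0) :+ q :* s) p q (score zero j))
    race-swap (suc r) zero    = modulo p (race-swap r zero)
      (solve 3 (λ q a s → let p = con (+ 1) :- q in
        con (+ 1) := p :* a :+ q :* con (+ 1) :+ p :* s :+ (con (+ 1) :- (a :+ s)) :* p) q (race r 1)
          (score r zero))
    race-swap (suc r) (suc j) = trans (+-cong (*-congˡ (race-swap r (suc j))) (*-congˡ (race-swap (suc r) j)))
      (solve 6 (λ p q a b s t → p :* (a :+ s) :+ q :* (b :+ t) := p :* a :+ q :* b :+ (p :* s :+ q :* t))
        p q (race r (suc (suc j))) (race (suc r) (suc j)) (score r (suc j)) (score (suc r) j))

    0≤race : ∀ r j → 0# ≤ race r j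
    0≤race zero    zero    = <⇒≤ 0<½
    0≤race zero    (suc j) = ≤-refl
    0≤race (suc r) zero    = 0≤1
    0≤race (suc r) (suc j) = 0≤+ (0≤* 0≤p (0≤race r (suc j))) (0≤* 0≤q (0≤race (suc r) j))

    -- The weights satisfy p / (2p) + q / (2q) = 1.
    race≤ : ∀ r j → race r j ≤ (2# * p) ^ r * (2# * q) ^ j
    race≤ zero    zero    = ≤-by ½ (<⇒≤ 0<½) (trans ½+½≈1 (sym (*-identityˡ 1#)))
    race≤ zero    (suc j) = 0≤* 0≤1 (0≤^ (0≤* 0≤2 0≤q) (suc j))
    race≤ (suc r) zero    = ≤-respˡ (1^≈1 (suc r)) (≤-respʳ (sym (*-identityʳ _)) (^-monoˡ-≤ 0≤1
      (≤-by δ 0≤δ (solve 1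
        (λ q → con (+ 1) :+ (con (+ 1) :- con (+ 2) :* q) := con (+ 2) :* (con (+ 1) :- q)) q)) (suc r)))
    race≤ (suc r) (suc j) = ≤-respʳ
      (solve 4 (λ p q t s → p :* (t :* (con (+ 2) :* q :* s)) :+ q :* (con (+ 2) :* p :* t :* s) :=
        con (+ 2) :* p :* t :* (con (+ 2) :* q :* s))
        p q ((2# * p) ^ r) ((2# * q) ^ j))
      (+-mono-≤ (*-monoʳ-≤ 0≤p (race≤ r (suc j))) (*-monoʳ-≤ 0≤q (race≤ (suc r) j)))

    κ*q≈p : κ * q ≈ p
    κ*q≈p = modulo p q*q⁻¹≈1 (solve 3 (λ p q i → p :* i :* q := p :+ (q :* i :- con (+ 1)) :* p) p q q⁻¹)

    ρ*p≈q : ρ * p ≈ q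
    ρ*p≈q = modulo q p*p⁻¹≈1 (solve 3 (λ p q i → q :* i :* p := q :+ (p :* i :- con (+ 1)) :* q) p q p⁻¹)

    weight : ℕ → ℕ → Carrier
    weight zero    j = 0#
    weight (suc r) j = j · 1# * score j r

    -- The boundary term in its second form, needed to express both predecessors in the moment
    -- recursions by the same `score j r`. The value 0 of `weight` at r = 0 fits this form.
    weight-suc : ∀ r j → weight r (suc j) ≈ κ * (r · 1#) * score j r
    weight-suc zero    j = solve 2 (λ κ s → con (+ 0) := κ :* con (+ 0) :* s) κ (score j zero)
    weight-suc (suc r) j = begin
      (suc j · 1#) * score (suc j) r                          ≈⟨ score-sucˡ j r ⟩
      (1# + j · 1# + r · 1#) * (p * score j r)                ≈⟨ *-congˡ (*-congʳ κ*q≈p) ⟨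
      (1# + j · 1# + r · 1#) * (κ * q * score j r)
        ≈⟨ solve 4 (λ m κ q s → m :* (κ :* q :* s) := κ :* (m :* (q :* s))) _ κ q (score j r) ⟩
      κ * ((1# + j · 1# + r · 1#) * (q * score j r))          ≈⟨ *-congˡ (score-sucʳ j r) ⟨
      κ * ((suc r · 1#) * score j (suc r))                    ≈⟨ *-assoc κ _ _ ⟨
      κ * (suc r · 1#) * score j (suc r)                      ∎
      where open SetoidReasoning setoid

    -- With the roles of the teams exchanged, let m be the number of goals G scores before B scores r.
    -- Then moment₁ and moment₂ are the expectations of j - m and (j - m)² on m < j; the factor κʳρʲ, which
    -- includes the probability that B catches up, turns them into expectations in the original game.
    moment₁ moment₂ : ℕ → ℕ → Carrier
    moment₁ r j = (j · 1# - r · 1# * κ) * race j r + weight r j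
    moment₂ r j = ((j · 1# - κ * (r · 1#)) * (j · 1# - κ * (r · 1#)) + κ * (r · 1#) * (1# + κ)) * race j r
      + (j · 1# - κ * (1# + r · 1#)) * weight r j

    -- The variable m is negative binomial with mean rκ and variance rκ(1 + κ); the coefficients of
    -- `race` in both moments are the unrestricted expectations, and `weight` corrects for the
    -- restriction to m < j. Everything is expressed by one race and one score, leaving a polynomial
    -- identity modulo κq = p.
    moment₁-suc : ∀ r j → moment₁ (suc r) (suc j) ≈ q * moment₁ r (suc j) + p * moment₁ (suc r) j
    moment₁-suc r j = begin
      (1# + j′ - (1# + r′) * κ) * (p * race j (suc r) + q * race (suc j) r) + weight (suc r) (suc j)
        ≈⟨ +-cong (*-congˡ (+-congˡ (*-congˡ (race-swap j r)))) (score-sucˡ j r) ⟩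
      (1# + j′ - (1# + r′) * κ) * (p * a + q * (a + s)) + (1# + j′ + r′) * (p * s)
        ≈⟨ modulo (- (a + s + r′ * s)) κ*q≈p
          (solve 7 (λ r j p q κ a s → let 1+ = λ x → con (+ 1) :+ x in
            (1+ j :- 1+ r :* κ) :* (p :* a :+ q :* (a :+ s)) :+ (1+ j :+ r) :* (p :* s) :=
            q :* ((1+ j :- r :* κ) :* (a :+ s) :+ κ :* r :* s) :+ p :* ((j :- 1+ r :* κ) :* a :+ j :* s)
              :+ (κ :* q :- p) :* :- (a :+ s :+ r :* s))
            r′ j′ p q κ a s) ⟩
      q * ((1# + j′ - r′ * κ) * (a + s) + κ * r′ * s) + p * ((j′ - (1# + r′) * κ) * a + j′ * s)
        ≈⟨ +-congʳ (*-congˡ (+-cong (*-congˡ (race-swap j r)) (weight-suc r j))) ⟨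
      q * moment₁ r (suc j) + p * moment₁ (suc r) j ∎
      where
      open SetoidReasoning setoid
      r′ = r · 1#
      j′ = j · 1#
      a = race j (suc r)
      s = score j r

    moment₂-suc : ∀ r j → moment₂ (suc r) (suc j) ≈ q * moment₂ r (suc j) + p * moment₂ (suc r) j
    moment₂-suc r j = begin
      moment₂ (suc r) (suc j)
        ≈⟨ +-cong (*-congˡ (+-congˡ (*-congˡ (race-swap j r)))) (*-congˡ (score-sucˡ j r)) ⟩
      (σ * σ + κ * (1# + r′) * (1# + κ)) * (p * a + q * (a + s))
        + (1# + j′ - κ * (1# + (1# + r′))) * ((1# + j′ + r′) * (p * s))
        ≈⟨ modulo ((1# - 2# * σ) * (a + s) - σ * r′ * s) κ*q≈p
          (solve 7 (λ r j p q κ a s → let 1+ = λ x → con (+ 1) :+ x ; σ = 1+ j :- κ :* 1+ r in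
            (σ :* σ :+ κ :* 1+ r :* 1+ κ) :* (p :* a :+ q :* (a :+ s))
              :+ (1+ j :- κ :* 1+ (1+ r)) :* ((1+ j :+ r) :* (p :* s)) :=
            q :* (((1+ j :- κ :* r) :* (1+ j :- κ :* r) :+ κ :* r :* 1+ κ) :* (a :+ s) :+ σ :* (κ :* r :* s))
              :+ p :* (((j :- κ :* 1+ r) :* (j :- κ :* 1+ r) :+ κ :* 1+ r :* 1+ κ) :* a
                :+ (j :- κ :* 1+ (1+ r)) :* (j :* s))
              :+ (κ :* q :- p) :* ((con (+ 1) :- con (+ 2) :* σ) :* (a :+ s) :- σ :* r :* s))
            r′ j′ p q κ a s) ⟩
      q * (((1# + j′ - κ * r′) * (1# + j′ - κ * r′) + κ * r′ * (1# + κ)) * (a + s) + σ * (κ * r′ * s))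
        + p * moment₂ (suc r) j
        ≈⟨ +-congʳ (*-congˡ (+-cong (*-congˡ (race-swap j r)) (*-congˡ (weight-suc r j)))) ⟨
      q * moment₂ r (suc j) + p * moment₂ (suc r) j ∎
      where
      open SetoidReasoning setoid
      r′ = r · 1#
      j′ = j · 1#
      a = race j (suc r)
      s = score j r
      σ = 1# + j′ - κ * (1# + r′)

    4pq : Carrier
    4pq = (2# + 2#) * p * q

    module _ (α β γ : Carrier) where

      -- The bracket of `value`, with the powers 1, i, i² of the gap replaced by their expectations
      -- on m < j in the exchanged game.
      caught : ℕ → ℕ → Carrier
      caught r j =
        α * race j r + β * (D * moment₁ r j) + γ * (D * D * moment₂ r j + 4pq * (D * D * D) * moment₁ r j)

      caught-suc : ∀ r j → caught (suc r) (suc j) ≈ q * caught r (suc j) + p * caught (suc r) j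
      caught-suc r j = trans
        (+-cong (+-congˡ (*-congˡ (*-congˡ (moment₁-suc r j))))
          (*-congˡ (+-cong (*-congˡ (moment₂-suc r j)) (*-congˡ (moment₁-suc r j)))))
        (solve 13 (λ α β γ p q D f a₁ a₂ m₁ m₂ n₁ n₂ →
          α :* (p :* a₂ :+ q :* a₁) :+ β :* (D :* (q :* m₁ :+ p :* m₂))
            :+ γ :* (D :* D :* (q :* n₁ :+ p :* n₂) :+ f :* (D :* D :* D) :* (q :* m₁ :+ p :* m₂)) :=
          q :* (α :* a₁ :+ β :* (D :* m₁) :+ γ :* (D :* D :* n₁ :+ f :* (D :* D :* D) :* m₁))
            :+ p :* (α :* a₂ :+ β :* (D :* m₂) :+ γ :* (D :* D :* n₂ :+ f :* (D :* D :* D) :* m₂)))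
          α β γ p q D 4pq (race (suc j) r) (race j (suc r)) (moment₁ r (suc j)) (moment₁ (suc r) j)
          (moment₂ r (suc j)) (moment₂ (suc r) j))

      -- The summands belong to B leading or level after Phase I, with duration 0, and to B behind.
      -- If B scores m < j goals while G scores r, the path weighs pʳqᵐ, and pʳqᵐ ρ^(j - m) = κʳρʲ
      -- qʳpᵐ: the probability of catching up exchanges p and q.
      phaseI-value : ℕ → ℕ → Carrier
      phaseI-value r j = α * race r j + κ ^ r * ρ ^ j * caught r j

      phaseI-value-zeroˡ : ∀ j → phaseI-value 0 j ≈ value α β γ j
      phaseI-value-zeroˡ zero    = modulo α ½+½≈1
        (solve 8 (λ α β γ p q D h κ →
          let 0′ = con (+ 0) ; 1′ = con (+ 1) ; f = (con (+ 2) :+ con (+ 2)) :* p :* q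
              m₁ = (0′ :- 0′ :* κ) :* h :+ 0′
              m₂ = ((0′ :- κ :* 0′) :* (0′ :- κ :* 0′) :+ κ :* 0′ :* (1′ :+ κ)) :* h
                :+ (0′ :- κ :* (1′ :+ 0′)) :* 0′
          in α :* h :+ 1′ :* 1′ :* (α :* h :+ β :* (D :* m₁)
            :+ γ :* (D :* D :* m₂ :+ f :* (D :* D :* D) :* m₁)) :=
             1′ :* (α :+ β :* (0′ :* D) :+ γ :* (0′ :* 0′ :* (D :* D) :+ f :* 0′ :* (D :* D :* D)))
               :+ (h :+ h :- 1′) :* α)
          α β γ p q D ½ κ)
      phaseI-value-zeroˡ (suc j) =
        solve 9 (λ α β γ p q D κ t r →
          let 0′ = con (+ 0) ; 1′ = con (+ 1) ; f = (con (+ 2) :+ con (+ 2)) :* p :* q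
              j = 1′ :+ t
              m₁ = (j :- 0′ :* κ) :* 1′ :+ 0′
              m₂ = ((j :- κ :* 0′) :* (j :- κ :* 0′) :+ κ :* 0′ :* (1′ :+ κ)) :* 1′
                :+ (j :- κ :* (1′ :+ 0′)) :* 0′
          in α :* 0′ :+ 1′ :* r :* (α :* 1′ :+ β :* (D :* m₁)
            :+ γ :* (D :* D :* m₂ :+ f :* (D :* D :* D) :* m₁)) :=
             r :* (α :+ β :* (j :* D) :+ γ :* (j :* j :* (D :* D) :+ f :* j :* (D :* D :* D))))
          α β γ p q D κ (j · 1#) (ρ ^ suc j)

      phaseI-value-zeroʳ : ∀ r → phaseI-value (suc r) 0 ≈ α
      phaseI-value-zeroʳ r =
        solve 10 (λ α β γ p q D κ t s k →
          let 0′ = con (+ 0) ; 1′ = con (+ 1) ; f = (con (+ 2) :+ con (+ 2)) :* p :* q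
              r = 1′ :+ t
              m₁ = (0′ :- r :* κ) :* 0′ :+ 0′ :* s
              m₂ = ((0′ :- κ :* r) :* (0′ :- κ :* r) :+ κ :* r :* (1′ :+ κ)) :* 0′
                :+ (0′ :- κ :* (1′ :+ r)) :* (0′ :* s)
          in α :* 1′ :+ k :* 1′ :* (α :* 0′ :+ β :* (D :* m₁)
            :+ γ :* (D :* D :* m₂ :+ f :* (D :* D :* D) :* m₁)) := α)
          α β γ p q D κ (r · 1#) (score zero r) (κ ^ suc r)

      phaseI-value-suc : ∀ r j → phaseI-value (suc r) (suc j) ≈ p * phaseI-value r (suc j)
        + q * phaseI-value (suc r) j
      phaseI-value-suc r j = trans (+-congˡ (*-congˡ (caught-suc r j)))
        (modulo₂ (k * l * ρ * M₁) (k * l * κ * M₂) κ*q≈p ρ*p≈q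
          (solve 11 (λ α p q κ ρ a b k l M₁ M₂ →
            α :* (p :* a :+ q :* b) :+ κ :* k :* (ρ :* l) :* (q :* M₁ :+ p :* M₂) :=
            p :* (α :* a :+ k :* (ρ :* l) :* M₁) :+ q :* (α :* b :+ κ :* k :* l :* M₂)
              :+ ((κ :* q :- p) :* (k :* l :* ρ :* M₁) :+ (ρ :* p :- q) :* (k :* l :* κ :* M₂)))
            α p q κ ρ (race r (suc j)) (race (suc r) j) k l M₁ M₂))
        where
        k = κ ^ r
        l = ρ ^ j
        M₁ = caught r (suc j)
        M₂ = caught (suc r) j

      -- At the start r = j = n, where the factor κʳρʲ is (κρ)ⁿ = 1.
      integral : ∀ {f} → (∀ d → f d ≈ quad α β γ d) → ∀ n → Integral q n f (α * race n n + caught n n)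
      integral f≈quad n = ⟶-resp (λ _ → refl)
        (+-congˡ (trans (*-congʳ (trans (sym (^-distrib-* κ ρ n)) (trans (^-congˡ n κρ≈1) (1^≈1 n))))
          (*-identityˡ _)))
        (phaseI-limit f≈quad phaseI-value phaseI-value-zeroˡ phaseI-value-zeroʳ phaseI-value-suc n n ≡.refl)
        where
        κρ≈1 : κ * ρ ≈ 1#
        κρ≈1 = modulo₂ (q * q⁻¹) 1# p*p⁻¹≈1 q*q⁻¹≈1
          (solve 4 (λ p q P Q → p :* Q :* (q :* P) :=
            con (+ 1) :+ ((p :* P :- con (+ 1)) :* (q :* Q) :+ (q :* Q :- con (+ 1)) :* con (+ 1)))
            p q p⁻¹ q⁻¹)

    -- Recurrences and decay of T and a

    open Asymptotics ℝ

    -- For n = k + 1, B is the first to score n goals with probability T k, and wins with probability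
    -- 2 T k; a k is the probability of the score (n - 1 , n), times p.
    T a : ℕ → Carrier
    T k = race (suc k) (suc k)
    a k = p * score k (suc k)

    -- Both sides are C(2n - 1, n) pⁿqⁿ with n = k + 1.
    a-sym : ∀ k → q * score (suc k) k ≈ a k
    a-sym k = *-cancelˡ-≈ (0<ν k) (modulo₂ q (- p) (score-sucˡ k k) (score-sucʳ k k)
      (solve 7 (λ p q ν m s s₁ s₂ → ν :* (q :* s₂) :=
        ν :* (p :* s₁) :+ ((ν :* s₂ :- m :* (p :* s)) :* q :+ (ν :* s₁ :- m :* (q :* s)) :* :- p))
        p q (ν k) (1# + k · 1# + k · 1#) (score k k) (score k (suc k)) (score (suc k) k)))

    -- B is first to n goals when it leads after 2n - 1 goals. Two more goals change the leader only
    -- from a lead of one: B loses the lead with probability p a and gains it with probability q a,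
    -- and p - q = δ.
    T-suc : ∀ k → T k ≈ T (suc k) + δ * a k
    T-suc k = trans
      (modulo₂ (p * p) (- q) (race-swap k (suc k)) (a-sym k)
        (solve 5 (λ q T u s₁ s₂ → let p = con (+ 1) :- q ; δ = con (+ 1) :- con (+ 2) :* q in
          T := p :* (p :* u :+ q :* T) :+ q :* (p :* T :+ q :* (T :+ s₂)) :+ δ :* (p :* s₁)
            :+ ((T :- (u :+ s₁)) :* (p :* p) :+ (q :* s₂ :- p :* s₁) :* :- q))
          q (T k) (race k (suc (suc k))) (score k (suc k)) (score (suc k) k)))
      (+-congʳ (+-congˡ (*-congˡ (+-congˡ (*-congˡ (sym (race-swap (suc k) k)))))))

    a-suc : ∀ k → (1# + x k) * a (suc k) ≈ 2# * p * q * (2# + x k) * a k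
    a-suc k = *-cancelˡ-≈ (0<ν k) (begin
      ν k * ((1# + x k) * a (suc k))
        ≈⟨ modulo (a (suc k)) (ν*x≈1 k) (solve 4 (λ ν x p s → ν :* ((con (+ 1) :+ x) :* (p :* s)) :=
          p :* ((con (+ 1) :+ ν) :* s) :+ (ν :* x :- con (+ 1)) :* (p :* s)) (ν k) (x k) p
            (score (suc k) (suc (suc k)))) ⟩
      p * (ν (suc k) * score (suc k) (suc (suc k)))
        ≈⟨ *-congˡ (score-sucʳ (suc k) (suc k)) ⟩
      p * ((1# + ν k + ν k) * (q * score (suc k) (suc k)))
        ≈⟨ *-congˡ (*-congˡ (*-congˡ center)) ⟩
      p * ((1# + ν k + ν k) * (q * (2# * a k)))
        ≈⟨ modulo (- (2# * p * q * a k)) (ν*x≈1 k)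
          (solve 5 (λ ν x p q a → p :* ((con (+ 1) :+ ν :+ ν) :* (q :* (con (+ 2) :* a))) :=
          ν :* (con (+ 2) :* p :* q :* (con (+ 2) :+ x) :* a)
            :+ (ν :* x :- con (+ 1)) :* :- (con (+ 2) :* p :* q :* a)) (ν k) (x k) p q (a k)) ⟩
      ν k * (2# * p * q * (2# + x k) * a k) ∎)
      where
      open SetoidReasoning setoid
      center : score (suc k) (suc k) ≈ 2# * a k
      center = *-cancelˡ-≈ (0<ν k) (trans (score-sucˡ k (suc k))
        (solve 3 (λ t p s → (con (+ 1) :+ t :+ (con (+ 1) :+ t)) :* (p :* s) :=
          (con (+ 1) :+ t) :* (con (+ 2) :* (p :* s))) (k · 1#) p (score k (suc k))))

    0<score : ∀ r j → 0# < score r j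
    0<score zero    zero    = 0<1
    0<score zero    (suc j) = *-pos 0<q (0<score zero j)
    0<score (suc r) zero    = *-pos 0<p (0<score r zero)
    0<score (suc r) (suc j) = 0<+ (*-pos 0<p (0<score r (suc j))) (<⇒≤ (*-pos 0<q (0<score (suc r) j)))

    0<a : ∀ k → 0# < a k
    0<a k = *-pos 0<p (0<score k (suc k))

    0≤a : ∀ k → 0# ≤ a k
    0≤a k = <⇒≤ (0<a k)

    τ : Carrier
    τ = 2# * p * (2# * q)

    0≤τ : 0# ≤ τ
    0≤τ = 0≤* (0≤* 0≤2 0≤p) (0≤* 0≤2 0≤q)

    τ+δ²≈1 : τ + δ * δ ≈ 1#
    τ+δ²≈1 = solve 1 (λ q → let δ = con (+ 1) :- con (+ 2) :* q in
      con (+ 2) :* (con (+ 1) :- q) :* (con (+ 2) :* q) :+ δ :* δ := con (+ 1)) q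

    τ<1 : τ < 1#
    τ<1 = <-by (δ * δ) (*-pos 0<δ 0<δ) τ+δ²≈1

    a-contracts : ∀ k → a (suc k) ≤ τ * a k
    a-contracts k = *-cancelˡ-≤ (0<+ 0<1 (0≤x k)) (≤-by (2# * p * q * x k * a k)
      (0≤* (0≤* (0≤* (0≤* 0≤2 0≤p) 0≤q) (0≤x k)) (0≤a k))
      (trans (+-congʳ (a-suc k)) (solve 4 (λ p q x a →
        con (+ 2) :* p :* q :* (con (+ 2) :+ x) :* a :+ con (+ 2) :* p :* q :* x :* a :=
        (con (+ 1) :+ x) :* (con (+ 2) :* p :* (con (+ 2) :* q) :* a)) p q (x k) (a k))))

    a≤ : ∀ k → a k ≤ τ ^ k * a 0
    a≤ zero    = ≤-reflexive (sym (*-identityˡ (a 0)))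
    a≤ (suc k) = ≤-trans (a-contracts k) (≤-respʳ (sym (*-assoc τ (τ ^ k) (a 0))) (*-monoʳ-≤ 0≤τ (a≤ k)))

    0≤T : ∀ k → 0# ≤ T k
    0≤T k = 0≤race (suc k) (suc k)

    T≤ : ∀ k → T k ≤ τ ^ suc k
    T≤ k = ≤-respʳ (sym (^-distrib-* (2# * p) (2# * q) (suc k))) (race≤ (suc k) (suc k))

    δa≤T : ∀ k → δ * a k ≤ T k
    δa≤T k = ≤-by (T (suc k)) (0≤T (suc k)) (trans (+-comm _ _) (sym (T-suc k)))

    -- The formal power series solution and its defect

    -- The scaled variable that clears the powers of δ from all denominators.
    y : ℕ → Carrier
    y k = x k * (D * D)

    δ²y≈x : ∀ k → δ * δ * y k ≈ x k
    δ²y≈x k = modulo (x k * (δ * D + 1#)) δ*D≈1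
      (solve 3 (λ δ D x → δ :* δ :* (x :* (D :* D)) :=
        x :+ (δ :* D :- con (+ 1)) :* (x :* (δ :* D :+ con (+ 1)))) δ D (x k))

    O-y : O 1 y
    O-y = O-* O-x (O-const (D * D))

    -- This is n / (n + 1), the inverse of 1 + 1/n; multiplying by it replaces division by `u`.
    ratio : ℕ → Carrier
    ratio k = ν k * x (suc k)

    y,q : Vec (ℕ → Carrier) 2
    y,q = y ∷ (λ _ → q) ∷ []

    module _ {m} (q : Polynomial m) where
      coefficient : List ℤ → Polynomial m
      coefficient []       = con (+ 0)
      coefficient (i ∷ is) = con i :+ q :* coefficient is

    Y Q P Δ U : Polynomial 2
    Y = var zero
    Q = var (suc zero)
    P = con (+ 1) :- Q
    Δ = con (+ 1) :- con (+ 2) :* Q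
    U = con (+ 1) :+ Δ :* Δ :* Y

    series : List (List ℤ) → Polynomial 2
    series []         = con (+ 0)
    series (is ∷ iss) = coefficient Q is :+ Y :* series iss

    -- The series at k + 1, with denominators cleared: y (k + 1) = y k / u k.
    homogenised : List (List ℤ) → Polynomial 2
    homogenised []         = con (+ 0)
    homogenised (is ∷ iss) = coefficient Q is :* U :^ length iss :+ Y :* homogenised iss

    -- Obtained by solving δT / a = Σ φᵢ yⁱ coefficient by coefficient in the recurrence for δT / a;
    -- row i lists the coefficients of φᵢ as a polynomial in q.
    Φ-coefficients : List (List ℤ)
    Φ-coefficients =
      (+ 1 ∷ []) ∷
      (+ 0 ∷ − + 2 ∷ + 2 ∷ []) ∷
      (+ 0 ∷ + 2 ∷ + 2 ∷ − + 8 ∷ + 4 ∷ []) ∷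
      (+ 0 ∷ − + 2 ∷ − + 18 ∷ + 32 ∷ + 4 ∷ − + 24 ∷ + 8 ∷ []) ∷
      (+ 0 ∷ + 2 ∷ + 58 ∷ + 24 ∷ − + 356 ∷ + 368 ∷ − + 48 ∷ − + 64 ∷ + 16 ∷ []) ∷
      (+ 0 ∷ − + 2 ∷ − + 146 ∷ − + 736 ∷ + 2020 ∷ + 584 ∷ − + 4376 ∷ + 3392 ∷ − + 608 ∷ − + 160 ∷ + 32 ∷ []) ∷
      (+ 0 ∷ + 2 ∷ + 330 ∷ + 4504 ∷ − + 1140 ∷ − + 34896 ∷ + 50448 ∷ + 768 ∷ − + 42288 ∷ + 27360 ∷ − + 4768
        ∷ − + 384 ∷ + 64 ∷ []) ∷
      []

    -- The recurrence for g = δT / a, with g′ its next value, is u g = δ²u + 2pq(2 + x) g′.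
    -- `Φ-defect` is the amount by which `Φ` violates it, times u⁶ to clear the denominators of the
    -- shifted series.
    Φ Φ-defect : Polynomial 2
    Φ = series Φ-coefficients
    Φ-defect = U :^ 7 :* Φ :- Δ :* Δ :* U :^ 7
      :- con (+ 2) :* P :* Q :* (con (+ 2) :+ Δ :* Δ :* Y) :* homogenised Φ-coefficients

    φ u defect : ℕ → Carrier
    φ k = ⟦ Φ ⟧ (at k y,q)
    u k = ⟦ U ⟧ (at k y,q)
    defect k = u k * φ k - δ * δ * u k - 2# * p * q * (2# + δ * δ * y k) * φ (suc k)

    u≈1+x : ∀ k → u k ≈ 1# + x k
    u≈1+x k = +-congˡ (δ²y≈x k)

    ratio*u≈1 : ∀ k → ratio k * u k ≈ 1#
    ratio*u≈1 k = begin
      ν k * x (suc k) * u k           ≈⟨ *-congˡ (u≈1+x k) ⟩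
      ν k * x (suc k) * (1# + x k)    ≈⟨ *-assoc _ _ _ ⟩
      ν k * (x (suc k) * (1# + x k))  ≈⟨ *-congˡ (x-suc k) ⟩
      ν k * x k                       ≈⟨ ν*x≈1 k ⟩
      1#                              ∎
      where open SetoidReasoning setoid

    y-suc : ∀ k → y (suc k) * u k ≈ y k
    y-suc k = begin
      x (suc k) * (D * D) * u k          ≈⟨ *-congˡ (u≈1+x k) ⟩
      x (suc k) * (D * D) * (1# + x k)   ≈⟨ solve 3 (λ x u d → x :* d :* u := x :* u :* d) _ _ _ ⟩
      x (suc k) * (1# + x k) * (D * D)   ≈⟨ *-congʳ (x-suc k) ⟩
      y k                                ∎
      where open SetoidReasoning setoid

    coefficient-const : ∀ is {y y′} → ⟦ coefficient Q is ⟧ (y ∷ q ∷ []) ≈ ⟦ coefficient Q is ⟧ (y′ ∷ q ∷ [])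
    coefficient-const []       = refl
    coefficient-const (i ∷ is) = +-congˡ (*-congˡ (coefficient-const is))

    -- The extra factor `u k` raises the exponent from length - 1 to the length, so that the
    -- induction can start at the empty series.
    homogenised*u : ∀ iss k → ⟦ homogenised iss ⟧ (at k y,q) * u k ≈ u k ^ length iss * ⟦ series iss ⟧
      (at (suc k) y,q)
    homogenised*u []         k = trans (zeroˡ (u k)) (sym (*-identityˡ 0#))
    homogenised*u (is ∷ iss) k = modulo₂ (y k) (- (U^l * S)) (homogenised*u iss k) (y-suc k) (trans
      (*-congʳ (+-congʳ (*-congʳ (coefficient-const is))))
      (solve 7 (λ c U^l y y′ u h S → (c :* U^l :+ y :* h) :* u :=
        u :* U^l :* (c :+ y′ :* S) :+ ((h :* u :- U^l :* S) :* y :+ (y′ :* u :- y) :* :- (U^l :* S)))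
        (⟦ coefficient Q is ⟧ (at (suc k) y,q)) U^l (y k) (y (suc k)) (u k)
          (⟦ homogenised iss ⟧ (at k y,q)) S))
      where
      U^l = u k ^ length iss
      S = ⟦ series iss ⟧ (at (suc k) y,q)

    defect*u⁷ : ∀ k → u k ^ 7 * defect k ≈ ⟦ Φ-defect ⟧ (at k y,q) * u k
    defect*u⁷ k = sym (modulo (- e) (homogenised*u Φ-coefficients k)
      (solve 7 (λ U^7 φ δδ u e h φ′ → (U^7 :* φ :- δδ :* U^7 :- e :* h) :* u :=
        U^7 :* (u :* φ :- δδ :* u :- e :* φ′) :+ (h :* u :- U^7 :* φ′) :* :- e)
        (u k ^ 7) (φ k) (δ * δ) (u k) e (⟦ homogenised Φ-coefficients ⟧ (at k y,q)) (φ (suc k))))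
      where
      e = 2# * p * q * (2# + δ * δ * y k)

    O-y,q : All (O 0) y,q
    O-y,q = O-weaken O-y ∷ O-const q ∷ []

    O-ratio : O 0 ratio
    O-ratio = O-bounded (λ k → 0≤⇒∣∣≤ (0≤* (<⇒≤ (0<ν k)) (0≤x (suc k)))
      (≤-respʳ (ν*x≈1 k) (*-monoʳ-≤ (<⇒≤ (0<ν k)) (x-anti k))))

    O-defect : O 7 (λ k → ratio k * defect k)
    O-defect = O-resp eq (O-* O-ratio (O-* (O-polynomial (O-ratio ∷ []) (var zero :^ 7))
      -- Here the coefficients of y⁰ to y⁶ in the defect are checked to vanish identically in q.
      (O-* (O-vanishing 7 Φ-defect tt O-y (O-const q ∷ [])) (O-polynomial O-y,q U))))
      where
      open SetoidReasoning setoid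
      eq : ∀ k → ratio k * (ratio k ^ 7 * (⟦ Φ-defect ⟧ (at k y,q) * u k)) ≈ ratio k * defect k
      eq k = *-congˡ (begin
        ratio k ^ 7 * (⟦ Φ-defect ⟧ (at k y,q) * u k)  ≈⟨ *-congˡ (defect*u⁷ k) ⟨
        ratio k ^ 7 * (u k ^ 7 * defect k)             ≈⟨ *-assoc _ _ _ ⟨
        ratio k ^ 7 * u k ^ 7 * defect k               ≈⟨ *-congʳ (^-distrib-* (ratio k) (u k) 7) ⟨
        (ratio k * u k) ^ 7 * defect k                 ≈⟨ *-congʳ (trans (^-congˡ 7 (ratio*u≈1 k)) (1^≈1 7)) ⟩
        1# * defect k                                  ≈⟨ *-identityˡ (defect k) ⟩
        defect k                                       ∎)

    O-φ : O 0 φ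
    O-φ = O-polynomial O-y,q Φ

    -- From the defect of the series to its error

    -- This is a(g - φ). Undivided by `a`, it tends to 0, so its recurrence can be summed from
    -- infinity.
    error : ℕ → Carrier
    error k = δ * T k - φ k * a k

    error-suc : ∀ k → error k ≈ error (suc k) - ratio k * defect k * a k
    error-suc k = modulo δ (T-suc k) (modulo₂ (φ k * a k - δ * δ * a k) (- φ (suc k)) (ratio*u≈1 k) a-suc′
      (solve 10 (λ δ T T′ a a′ φ φ′ w u e →
        δ :* T :- φ :* a :=
        δ :* T′ :- φ′ :* a′ :- w :* (u :* φ :- δ :* δ :* u :- e :* φ′) :* a :+ (T :- (T′ :+ δ :* a)) :* δ
          :+ ((w :* u :- con (+ 1)) :* (φ :* a :- δ :* δ :* a) :+ (w :* (e :* a) :- a′) :* :- φ′))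
        δ (T k) (T (suc k)) (a k) (a (suc k)) (φ k) (φ (suc k)) (ratio k) (u k)
          (2# * p * q * (2# + δ * δ * y k))))
      where
      open SetoidReasoning setoid
      a-suc′ : ratio k * (2# * p * q * (2# + δ * δ * y k) * a k) ≈ a (suc k)
      a-suc′ = begin
        ratio k * (2# * p * q * (2# + δ * δ * y k) * a k)
          ≈⟨ *-congˡ (*-congʳ (*-congˡ (+-congˡ (δ²y≈x k)))) ⟩
        ratio k * (2# * p * q * (2# + x k) * a k)          ≈⟨ *-congˡ (a-suc k) ⟨
        ratio k * ((1# + x k) * a (suc k))                 ≈⟨ *-congˡ (*-congʳ (u≈1+x k)) ⟨
        ratio k * (u k * a (suc k))                        ≈⟨ *-assoc _ _ _ ⟨
        ratio k * u k * a (suc k)                          ≈⟨ *-congʳ (ratio*u≈1 k) ⟩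
        1# * a (suc k)                                     ≈⟨ *-identityˡ _ ⟩
        a (suc k)                                          ∎

    module _ {C : Carrier} (defect≤ : ∀ k → ∣ ratio k * defect k ∣≤ C * x k ^ 7) (0≤C : 0# ≤ C) where

      private
        L : Carrier
        -- D² = 1 / (1 - τ) is the sum of the geometric series that bounds the accumulated defects.
        L = C * (D * D)
        0≤L : 0# ≤ L
        0≤L = 0≤* 0≤C (0≤* 0≤D 0≤D)

      -- The recurrence, run from k + j back to k, contracts by the factor τ < 1 at every step.
      error-pullback : ∀ j k {b} → ∣ error (j ℕ.+ k) ∣≤ b → ∣ error k ∣≤ b + L * x k ^ 7 * a k
      error-pullback zero    k {b} e≤b = ∣∣≤-weaken (≤-by _ (0≤* (0≤* 0≤L (0≤^ (0≤x k) 7)) (0≤a k)) refl) e≤b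
      error-pullback (suc j) k {b} e≤b = ∣∣≤-resp (sym (error-suc k)) (∣∣≤-weaken
        (≤-trans (+-monoˡ-≤ (C * x⁷ * a k) (+-mono-≤ (≤-refl {b}) (*-mono-≤
            (0≤* 0≤L (0≤^ (0≤x (suc k)) 7)) (*-monoʳ-≤ 0≤L (^-monoˡ-≤ (0≤x (suc k)) (x-anti k) 7))
              (0≤a (suc k)) (a-contracts k))))
          (≤-reflexive (modulo₂ (- (C * x⁷ * a k * (δ * D + 1#))) (L * x⁷ * a k) δ*D≈1 τ+δ²≈1
            (solve 7 (λ b C X a τ δ D → let L = C :* (D :* D) in
              b :+ L :* X :* (τ :* a) :+ C :* X :* a := b :+ L :* X :* a
                :+ ((δ :* D :- con (+ 1)) :* :- (C :* X :* a :* (δ :* D :+ con (+ 1)))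
                  :+ (τ :+ δ :* δ :- con (+ 1)) :* (L :* X :* a)))
              b C x⁷ (a k) τ δ D))))
        (∣∣≤-minus (error-pullback j (suc k) (≡.subst (λ i → ∣ error i ∣≤ b) (≡.sym (ℕ.+-suc j k)) e≤b))
               (∣∣≤-* (defect≤ k) (0≤⇒∣∣≤ (0≤a k) ≤-refl))))
        where x⁷ = x k ^ 7

      -- A crude bound, from T and a both decaying like τᵏ; its only purpose is to remove the end
      -- term when the recurrence is run to infinity.
      error-small : ∀ ε → 0# < ε → ∃[ N ] ∀ k → N ℕ.≤ k → ∣ error k ∣≤ ε
      error-small ε 0<ε = small O-φ
        where
        small : O 0 φ → ∃[ N ] ∀ k → N ℕ.≤ k → ∣ error k ∣≤ ε
        small φ-O@(b , φ≤b) = proj₁ geometric , λ k N≤k → ∣∣≤-weaken (<⇒≤ (proj₂ geometric k N≤k)) (error≤ k)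
          where
          M = δ * τ + b * 1# * a 0
          geometric = geometric-small 0≤τ τ<1 M (0≤+ (0≤* 0≤δ 0≤τ) (0≤* (0≤* (O⇒0≤ φ-O) 0≤1) (0≤a 0))) ε 0<ε
          error≤ : ∀ k → ∣ error k ∣≤ M * τ ^ k
          error≤ k = ∣∣≤-weaken
            (≤-reflexive
              (solve 5 (λ δ τ b a t → δ :* (τ :* t) :+ b :* (t :* a) := (δ :* τ :+ b :* a) :* t) δ τ (b * 1#)
                (a 0) (τ ^ k)))
            (∣∣≤-minus (∣∣≤-* (0≤⇒∣∣≤ 0≤δ ≤-refl) (0≤⇒∣∣≤ (0≤T k) (T≤ k)))
              (∣∣≤-* (φ≤b k) (0≤⇒∣∣≤ (0≤a k) (a≤ k))))

      error≤ : ∀ k → ∣ error k ∣≤ L * x k ^ 7 * a k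
      error≤ k = ∣∣≤-by-<ε λ ε 0<ε → pullback (error-small ε 0<ε)
        where
        pullback : ∀ {ε} → ∃[ N ] (∀ k → N ℕ.≤ k → ∣ error k ∣≤ ε) → ∣ error k ∣≤ ε + L * x k ^ 7 * a k
        pullback (N , small) = error-pullback N k (small (N ℕ.+ k) (ℕ.m≤m+n N k))

    a⁻¹ T⁻¹ : ℕ → Carrier
    a⁻¹ k = 0<x⇒x#0 (0<a k) ⁻¹

    0<T : ∀ k → 0# < T k
    0<T k = <-≤-trans (*-pos 0<δ (0<a k)) (δa≤T k)

    T⁻¹ k = 0<x⇒x#0 (0<T k) ⁻¹

    a*a⁻¹≈1 : ∀ k → a k * a⁻¹ k ≈ 1#
    a*a⁻¹≈1 k = ⁻¹-inverse (0<x⇒x#0 (0<a k))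

    T*T⁻¹≈1 : ∀ k → T k * T⁻¹ k ≈ 1#
    T*T⁻¹≈1 k = ⁻¹-inverse (0<x⇒x#0 (0<T k))

    0≤T⁻¹ : ∀ k → 0# ≤ T⁻¹ k
    0≤T⁻¹ k = <⇒≤ (0<⁻¹ (0<T k))

    g g⁻¹ : ℕ → Carrier
    g   k = δ * T k * a⁻¹ k
    g⁻¹ k = a k * (D * T⁻¹ k)

    g*a≈δT : ∀ k → g k * a k ≈ δ * T k
    g*a≈δT k = modulo (δ * T k) (a*a⁻¹≈1 k)
      (solve 3 (λ t a i → t :* i :* a := t :+ (a :* i :- con (+ 1)) :* t) (δ * T k) (a k) (a⁻¹ k))

    g*g⁻¹≈1 : ∀ k → g k * g⁻¹ k ≈ 1#
    g*g⁻¹≈1 k = begin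
      δ * T k * a⁻¹ k * (a k * (D * T⁻¹ k))
        ≈⟨ solve 6 (λ δ T i a D j → δ :* T :* i :* (a :* (D :* j)) := a :* i :* (δ :* D) :* (T :* j)) δ (T k)
          (a⁻¹ k) (a k) D (T⁻¹ k) ⟩
      a k * a⁻¹ k * (δ * D) * (T k * T⁻¹ k)     ≈⟨ *-cong (*-cong (a*a⁻¹≈1 k) δ*D≈1) (T*T⁻¹≈1 k) ⟩
      1# * 1# * 1#
        ≈⟨ solve 0 (con (+ 1) :* con (+ 1) :* con (+ 1) := con (+ 1)) ⟩
      1#                                        ∎
      where open SetoidReasoning setoid

    O-g-φ : O 7 (λ k → g k - φ k)
    O-g-φ = bound O-defect
      where
      bound : O 7 (λ k → ratio k * defect k) → O 7 (λ k → g k - φ k)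
      bound d-O@(C , defect≤) = C * (D * D) , λ k → ∣∣≤-cancelˡ (0<a k) (∣∣≤-resp
        (trans (+-congʳ (sym (g*a≈δT k)))
          (solve 3 (λ g φ a → g :* a :- φ :* a := a :* (g :- φ)) (g k) (φ k) (a k)))
        (∣∣≤-weaken (≤-reflexive (*-comm _ (a k))) (error≤ defect≤ (O⇒0≤ d-O) k)))
        where
        ∣∣≤-cancelˡ : ∀ {z s b} → 0# < z → ∣ z * s ∣≤ z * b → ∣ s ∣≤ b
        ∣∣≤-cancelˡ {z} {s} {b} 0<z (lo , hi) =
          *-cancelˡ-≤ 0<z (≤-respˡ (solve 2 (λ z b → :- (z :* b) := z :* :- b) z b) lo) , *-cancelˡ-≤ 0<z hi

    O-g : O 0 g
    O-g = O-resp {s = λ k → φ k + (g k - φ k)} {t = g}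
      (λ k → solve 2 (λ g φ → φ :+ (g :- φ) := g) (g k) (φ k))
      (O-+ O-φ (O-weaken⁷ O-g-φ))
      where
      O-weaken⁷ : ∀ {s} → O 7 s → O 0 s
      O-weaken⁷ b = O-weaken (O-weaken (O-weaken (O-weaken (O-weaken (O-weaken (O-weaken b))))))

    -- The lower bound δa ≤ T keeps g away from 0, so the final division by g² costs no order.
    g⁻¹≤D² : ∀ k → g⁻¹ k ≤ D * D
    g⁻¹≤D² k = ≤-by (D * D * T⁻¹ k * (T k - δ * a k))
      (0≤* (0≤* (0≤* 0≤D 0≤D) (0≤T⁻¹ k)) (0≤y-x (δa≤T k)))
      (modulo₂ (- (a k * D * T⁻¹ k)) (D * D) δ*D≈1 (T*T⁻¹≈1 k)
        (solve 5 (λ a D i T δ → a :* (D :* i) :+ D :* D :* i :* (T :- δ :* a) :=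
          D :* D :+ ((δ :* D :- con (+ 1)) :* :- (a :* D :* i) :+ (T :* i :- con (+ 1)) :* (D :* D)))
          (a k) D (T⁻¹ k) (T k) δ))

    O-g⁻¹ : O 0 g⁻¹
    O-g⁻¹ = O-bounded {s = g⁻¹} {b = D * D} (λ k → 0≤⇒∣∣≤ (0≤* (0≤a k) (0≤* 0≤D (0≤T⁻¹ k))) (g⁻¹≤D² k))

    /-* : ∀ {x y} (y#0 : y # 0#) → x / y [ y#0 ] * y ≈ x
    /-* {x} {y} y#0 =
      modulo x (⁻¹-inverse y#0)
        (solve 3 (λ x y i → x :* i :* y := x :+ (y :* i :- con (+ 1)) :* x) x y (y#0 ⁻¹))

    -- The conditional variance as a function of n and g

    module Variance (k : ℕ) where

      2T I₁ I₂ : Carrier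
      2T = 2# * T k
      I₁ = D * moment₁ (suc k) (suc k)
      I₂ = D * D * moment₂ (suc k) (suc k) + 4pq * (D * D * D) * moment₁ (suc k) (suc k)

      0<2T : 0# < 2T
      0<2T = *-pos (0<+ 0<1 0≤1) (0<T k)

      2T#0 : 2T # 0#
      2T#0 = 0<x⇒x#0 0<2T

      integral-quad : ∀ {f α β γ} → (∀ d → f d ≈ quad α β γ d) →
        Integral q (suc k) f (α * 2T + β * I₁ + γ * I₂)
      integral-quad {f} {α} {β} {γ} f≈quad = ⟶-resp (λ _ → refl)
        (solve 6 (λ α β γ T I₁ I₂ → α :* T :+ (α :* T :+ β :* I₁ :+ γ :* I₂) :=
          α :* (con (+ 2) :* T) :+ β :* I₁ :+ γ :* I₂)
          α β γ (T k) I₁ I₂)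
        (integral α β γ f≈quad (suc k))

      integral-1 : Integral q (suc k) (λ _ → 1#) 2T
      integral-1 = ⟶-resp (λ _ → refl)
        (solve 3 (λ T I₁ I₂ → con (+ 1) :* T :+ con (+ 0) :* I₁ :+ con (+ 0) :* I₂ := T) 2T I₁ I₂)
        (integral-quad λ d → solve 1 (λ t → con (+ 1) := con (+ 1) :+ con (+ 0) :* t :+ con (+ 0) :* (t :* t))
          (d · 1#))

      integral-d : Integral q (suc k) (λ d → d · 1#) I₁
      integral-d = ⟶-resp (λ _ → refl)
        (solve 3 (λ T I₁ I₂ → con (+ 0) :* T :+ con (+ 1) :* I₁ :+ con (+ 0) :* I₂ := I₁) 2T I₁ I₂)
        (integral-quad λ d → solve 1
          (λ t → t := con (+ 0) :+ con (+ 1) :* t :+ con (+ 0) :* (t :* t)) (d · 1#))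

      integral-square : ∀ μ → Integral q (suc k) (λ d → (d · 1# - μ) ^ 2) (I₂ - 2# * μ * I₁ + μ * μ * 2T)
      integral-square μ = ⟶-resp (λ _ → refl)
        (solve 4 (λ T I₁ I₂ μ → μ :* μ :* T :+ :- (con (+ 2) :* μ) :* I₁ :+ con (+ 1) :* I₂ :=
          I₂ :- con (+ 2) :* μ :* I₁ :+ μ :* μ :* T) 2T I₁ I₂ μ)
        (integral-quad λ d → solve 2
          (λ t μ → (t :- μ) :* ((t :- μ) :* con (+ 1)) :=
            μ :* μ :+ :- (con (+ 2) :* μ) :* t :+ con (+ 1) :* (t :* t)) (d · 1#) μ)

      variance-exists : ∃[ v ] IsConditionalVariance q (suc k) v
      variance-exists = _ , I₁ / 2T [ 2T#0 ] ,
        (2T , I₁ , 2T#0 , integral-1 , integral-d , refl) ,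
        (2T , _ , 2T#0 , integral-1 , integral-square (I₁ / 2T [ 2T#0 ]) , refl)

      -- Uniqueness of limits identifies the existentially given integrals with the computed ones.
      expectation : ∀ {f s e} → Integral q (suc k) f s → IsConditionalExpectation q (suc k) f e → e * 2T ≈ s
      expectation {f} {s} {e} f-s (p′ , s′ , p′#0 , 1-p′ , f-s′ , e≈) = begin
        e * 2T                    ≈⟨ *-cong e≈ (⟶-unique integral-1 1-p′) ⟩
        s′ / p′ [ p′#0 ] * p′     ≈⟨ /-* p′#0 ⟩
        s′                        ≈⟨ ⟶-unique f-s′ f-s ⟩
        s                         ∎
        where open SetoidReasoning setoid

      variance-formula : ∀ {v} → IsConditionalVariance q (suc k) v → v * 2T * 2T ≈ 2T * I₂ - I₁ * I₁
      variance-formula {v} (μ , mean , square) = begin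
        v * 2T * 2T                                   ≈⟨ *-congʳ (expectation (integral-square μ) square) ⟩
        (I₂ - 2# * μ * I₁ + μ * μ * 2T) * 2T          ≈⟨ modulo (μ * 2T - I₁) (expectation integral-d mean)
          (solve 4 (λ T I₁ I₂ μ → (I₂ :- con (+ 2) :* μ :* I₁ :+ μ :* μ :* T) :* T :=
            T :* I₂ :- I₁ :* I₁ :+ (μ :* T :- I₁) :* (μ :* T :- I₁)) 2T I₁ I₂ μ) ⟩
        2T * I₂ - I₁ * I₁                             ∎
        where open SetoidReasoning setoid

      private
        m₁ m₂ w : Carrier
        m₁ = moment₁ (suc k) (suc k)
        m₂ = moment₂ (suc k) (suc k)
        w  = weight (suc k) (suc k)

        q*w≈νa : q * w ≈ ν k * a k
        q*w≈νa = trans (solve 3 (λ q ν s → q :* (ν :* s) := ν :* (q :* s)) q (ν k) (score (suc k) k))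
          (*-congˡ (a-sym k))

      qm₁ : q * m₁ ≈ ν k * (a k - δ * T k)
      qm₁ = modulo₂ (- (ν k * T k)) 1# κ*q≈p q*w≈νa
        (solve 6 (λ q κ ν T w a → let p = con (+ 1) :- q ; δ = con (+ 1) :- con (+ 2) :* q in
          q :* ((ν :- ν :* κ) :* T :+ w) := ν :* (a :- δ :* T) :+
            ((κ :* q :- p) :* :- (ν :* T) :+ (q :* w :- ν :* a) :* con (+ 1)))
          q κ (ν k) (T k) w (a k))

      q²m₂ : q * q * m₂ ≈ (δ * δ * ν k * ν k + p * ν k) * T k - (δ * ν k + p) * (ν k * a k)
      q²m₂ = modulo₂
        ((ν k * ν k * (κ * q + p - 2# * q) + ν k * (q + κ * q + p)) * T k - (1# + ν k) * (q * w))
          (q * ν k - p * (1# + ν k))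
        κ*q≈p q*w≈νa
        (solve 6 (λ q κ ν T w a → let p = con (+ 1) :- q ; δ = con (+ 1) :- con (+ 2) :* q ; 1+ν = con (+ 1) :+ ν in
          q :* q :* (((ν :- κ :* ν) :* (ν :- κ :* ν) :+ κ :* ν :* (con (+ 1) :+ κ)) :* T
            :+ (ν :- κ :* 1+ν) :* w) :=
          (δ :* δ :* ν :* ν :+ p :* ν) :* T :- (δ :* ν :+ p) :* (ν :* a) :+
            ((κ :* q :- p) :* ((ν :* ν :* (κ :* q :+ p :- con (+ 2) :* q) :+ ν :* (q :+ κ :* q :+ p)) :* T
              :- 1+ν :* (q :* w))
              :+ (q :* w :- ν :* a) :* (q :* ν :- p :* 1+ν)))
          q κ (ν k) (T k) w (a k))

      qm₁-scaled : x k * (q * m₁) * a⁻¹ k ≈ 1# - g k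
      qm₁-scaled =
        trans (*-congʳ (*-congˡ qm₁)) (modulo₂ (a k * a⁻¹ k - δ * T k * a⁻¹ k) 1# (ν*x≈1 k) (a*a⁻¹≈1 k)
        (solve 6 (λ x ν a i δ T → x :* (ν :* (a :- δ :* T)) :* i := con (+ 1) :- δ :* T :* i :+
          ((ν :* x :- con (+ 1)) :* (a :* i :- δ :* T :* i) :+ (a :* i :- con (+ 1)) :* con (+ 1)))
          (x k) (ν k) (a k) (a⁻¹ k) δ (T k)))

      q²m₂-scaled : x k * x k * δ * (q * q * m₂) * a⁻¹ k ≈ (δ * δ + p * x k) * g k - δ * (δ + p * x k)
      q²m₂-scaled = trans (*-congʳ (*-congˡ q²m₂)) (modulo₂
        ((δ * δ * (ν k * x k + 1#) + p * x k) * (δ * T k * a⁻¹ k)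
          - δ * (δ * (ν k * x k + 1#) + p * x k) * (a k * a⁻¹ k))
        (- (δ * (δ + p * x k))) (ν*x≈1 k) (a*a⁻¹≈1 k)
        (solve 7 (λ x ν a i δ T p →
          x :* x :* δ :* ((δ :* δ :* ν :* ν :+ p :* ν) :* T :- (δ :* ν :+ p) :* (ν :* a)) :* i :=
          (δ :* δ :+ p :* x) :* (δ :* T :* i) :- δ :* (δ :+ p :* x) :+
            ((ν :* x :- con (+ 1)) :* ((δ :* δ :* (ν :* x :+ con (+ 1)) :+ p :* x) :* (δ :* T :* i)
              :- δ :* (δ :* (ν :* x :+ con (+ 1)) :+ p :* x) :* (a :* i))
              :+ (a :* i :- con (+ 1)) :* :- (δ :* (δ :+ p :* x))))
          (x k) (ν k) (a k) (a⁻¹ k) δ (T k) p))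

      -- `variance-formula` multiplied by q²x²δ²/a²: this factor turns T and both moments into
      -- polynomials in g and y. The right side is small of second order, as g is 1 + O(1/n), which
      -- matches the factor x² on the left.
      variance-equation : ∀ {v} → IsConditionalVariance q (suc k) v →
        (2# + 2#) * (q * q) * (x k * x k) * (g k * g k) * v ≈
        2# * g k * ((1# + p * y k) * g k - (1# + p * δ * y k) + (2# + 2#) * p * (q * q) * y k * (1# - g k))
          - (1# - g k) * (1# - g k)
      variance-equation {v} var-v = begin
        (2# + 2#) * (q * q) * (x k * x k) * (g k * g k) * v
          ≈⟨ solve 6 (λ q x δ T i v → let 2′ = con (+ 2) ; g = δ :* T :* i in
            (2′ :+ 2′) :* (q :* q) :* (x :* x) :* (g :* g) :* v :=
            q :* q :* (x :* x) :* (δ :* δ) :* (i :* i) :* (v :* (2′ :* T) :* (2′ :* T))) q (x k) δ (T k)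
              (a⁻¹ k) v ⟩
        q * q * (x k * x k) * (δ * δ) * (a⁻¹ k * a⁻¹ k) * (v * 2T * 2T)
          ≈⟨ *-congˡ (variance-formula var-v) ⟩
        q * q * (x k * x k) * (δ * δ) * (a⁻¹ k * a⁻¹ k) * (2T * I₂ - I₁ * I₁)
          ≈⟨ solve 9 (λ q x δ T i D p m₁ m₂ → let 2′ = con (+ 2) ; f = (2′ :+ 2′) :* p :* q in
            q :* q :* (x :* x) :* (δ :* δ) :* (i :* i)
              :* (2′ :* T :* (D :* D :* m₂ :+ f :* (D :* D :* D) :* m₁) :- D :* m₁ :* (D :* m₁)) :=
            2′ :* (δ :* T :* i) :* (D :* D :* (x :* x :* δ :* (q :* q :* m₂) :* i)
              :+ f :* q :* (δ :* D) :* (D :* D :* x) :* (x :* (q :* m₁) :* i))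
              :- δ :* D :* (δ :* D) :* ((x :* (q :* m₁) :* i) :* (x :* (q :* m₁) :* i)))
            q (x k) δ (T k) (a⁻¹ k) D p m₁ m₂ ⟩
        2# * g k * (D * D * (x k * x k * δ * (q * q * m₂) * a⁻¹ k)
          + 4pq * q * (δ * D) * (D * D * x k) * (x k * (q * m₁) * a⁻¹ k))
          - δ * D * (δ * D) * ((x k * (q * m₁) * a⁻¹ k) * (x k * (q * m₁) * a⁻¹ k))
          ≈⟨ +-cong (*-congˡ (+-cong (*-congˡ q²m₂-scaled) (*-congˡ qm₁-scaled)))
            (-‿cong (*-congˡ (*-cong qm₁-scaled qm₁-scaled))) ⟩
        2# * g k * (D * D * ((δ * δ + p * x k) * g k - δ * (δ + p * x k))
          + 4pq * q * (δ * D) * (D * D * x k) * (1# - g k))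
          - δ * D * (δ * D) * ((1# - g k) * (1# - g k))
          ≈⟨ modulo (2# * g k * (g k * (δ * D + 1#) - (δ * D + 1#) + 4pq * q * (D * D * x k) * (1# - g k))
            - (δ * D + 1#) * ((1# - g k) * (1# - g k))) δ*D≈1
            (solve 6 (λ g D δ p q x → let 2′ = con (+ 2) ; 1′ = con (+ 1) ; f = (2′ :+ 2′) :* p :* q ; y = x :* (D :* D) in
              2′ :* g :* (D :* D :* ((δ :* δ :+ p :* x) :* g :- δ :* (δ :+ p :* x))
                :+ f :* q :* (δ :* D) :* (D :* D :* x) :* (1′ :- g))
                :- δ :* D :* (δ :* D) :* ((1′ :- g) :* (1′ :- g)) :=
              2′ :* g :* ((1′ :+ p :* y) :* g :- (1′ :+ p :* δ :* y)
                :+ (2′ :+ 2′) :* p :* (q :* q) :* y :* (1′ :- g)) :- (1′ :- g) :* (1′ :- g)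
                :+ (δ :* D :- 1′)
                  :* (2′ :* g :* (g :* (δ :* D :+ 1′) :- (δ :* D :+ 1′)
                    :+ f :* q :* (D :* D :* x) :* (1′ :- g))
                  :- (δ :* D :+ 1′) :* ((1′ :- g) :* (1′ :- g))))
              (g k) D δ p q (x k)) ⟩
        2# * g k * ((1# + p * y k) * g k - (1# + p * δ * y k) + (2# + 2#) * p * (q * q) * y k * (1# - g k))
          - (1# - g k) * (1# - g k) ∎
        where open SetoidReasoning setoid

    -- Comparison with the stated expansion

    infixr 8 _:·_
    _:·_ : ∀ {m} → ℕ → Polynomial m → Polynomial m
    n :· e = con (+ n) :* e

    module _ {m} (q : Polynomial m) where

      e₀ e₁ e₂ e₃ e₄ : Polynomial m
      e₀ = (q :- con (+ 1)) :* (4 :· q :^ 2 :- 3 :· q :- 2 :· con (+ 1))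
      e₁ = (q :- con (+ 1)) :* (4 :· q :^ 2 :+ 2 :· q :- 7 :· con (+ 1))
      e₂ = (q :- con (+ 1)) :* (24 :· q :^ 4 :- 12 :· q :^ 3 :- 58 :· q :^ 2 :+ 29 :· q :+ 18 :· con (+ 1))
      e₃ = (q :- con (+ 1)) :* (144 :· q :^ 6 :- 216 :· q :^ 5 :- 348 :· q :^ 4 :+ 444 :· q :^ 3
        :+ 328 :· q :^ 2
             :- 312 :· q :- 41 :· con (+ 1))
      e₄ = (q :- con (+ 1)) :* (864 :· q :^ 8 :- 2160 :· q :^ 7 :- 1704 :· q :^ 6 :+ 4956 :· q :^ 5
        :+ 4632 :· q :^ 4
             :- 9972 :· q :^ 3 :+ 1586 :· q :^ 2 :+ 1711 :· q :+ 88 :· con (+ 1))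

      -- With y = 1 / (δ²n), this is δ⁴ times the expansion in the theorem.
      E : Polynomial m → Polynomial m
      E y = e₀ :- e₁ :* y :- e₂ :* y :^ 2 :- e₃ :* y :^ 3 :- e₄ :* y :^ 4

      -- Right side minus left side of `variance-equation`, with E / δ⁴ in place of the variance;
      -- the δ⁴ turns x² into y².
      residual : Polynomial m → Polynomial m → Polynomial m
      residual g y =
        let p = con (+ 1) :- q ; δ = con (+ 1) :- con (+ 2) :* q in
        con (+ 2) :* g :* ((con (+ 1) :+ p :* y) :* g :- (con (+ 1) :+ p :* δ :* y)
          :+ (con (+ 2) :+ con (+ 2)) :* p :* (q :* q) :* y :* (con (+ 1) :- g))
            :- (con (+ 1) :- g) :* (con (+ 1) :- g)
          :- (con (+ 2) :+ con (+ 2)) :* (q :* q) :* (y :* y) :* (g :* g) :* E y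

      -- The divided difference of `residual` in its first argument, which bounds the cost of
      -- replacing g by its approximation.
      residual-slope : Polynomial m → Polynomial m → Polynomial m → Polynomial m
      residual-slope g f y =
        let p = con (+ 1) :- q ; δ = con (+ 1) :- con (+ 2) :* q in
        (con (+ 2) :* (con (+ 1) :+ p :* y) :- con (+ 8) :* p :* (q :* q) :* y :- con (+ 1)
          :- con (+ 4) :* (q :* q) :* (y :* y) :* E y) :* (g :+ f)
          :- con (+ 2) :* (con (+ 1) :+ p :* δ :* y) :+ con (+ 8) :* p :* (q :* q) :* y :+ con (+ 2)

    Eₖ Rₖ : ℕ → Carrier
    Eₖ k = ⟦ E Q Y ⟧ (at k y,q)
    Rₖ k = ⟦ residual (var (suc (suc zero))) (var zero) (var (suc zero)) ⟧ (g k ∷ y k ∷ q ∷ [])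

    -- At `Φ` the coefficients below y⁷ vanish, by evaluation of the polynomial; passing from `Φ` to
    -- g changes the residual by a bounded multiple of g - φ, which has the same order.
    O-residual : O 7 Rₖ
    O-residual = O-resp {s = λ k → ⟦ residual Q Φ Y ⟧ (at k y,q) + (g k - φ k) * ⟦ slope ⟧ (at k σ)} {t = Rₖ}
      (λ k → sym (solve 4 (λ g f y q → residual q g y := residual q f y :+ (g :- f) :* residual-slope q g f y)
        (g k) (φ k) (y k) q))
      (O-+ (O-vanishing 7 (residual Q Φ Y) tt O-y (O-const q ∷ []))
           (O-* O-g-φ (O-polynomial {σ = σ} (O-g ∷ O-φ ∷ O-weaken O-y ∷ O-const q ∷ []) slope)))
      where
      σ : Vec (ℕ → Carrier) 4
      σ = g ∷ φ ∷ y ∷ (λ _ → q) ∷ []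
      slope : Polynomial 4
      slope = residual-slope (var (suc (suc (suc zero)))) (var zero) (var (suc zero)) (var (suc (suc zero)))


    D² : Carrier
    D² = D * D

    -- All exponents in the statement are even, so the denominators 2q - 1 and 1 - 2q are treated
    -- alike.
    even-power : ∀ {s} → s * s ≈ δ * δ → ∀ j → s ^ (j ℕ.* 2) * D² ^ j ≈ 1#
    even-power s²≈δ² zero    = *-identityˡ 1#
    even-power {s} s²≈δ² (suc j) = begin
      s * (s * s ^ (j ℕ.* 2)) * (D² * D² ^ j)
        ≈⟨ solve 4 (λ s S d e → s :* (s :* S) :* (d :* e) := s :* s :* d :* (S :* e)) s (s ^ (j ℕ.* 2)) D²
          (D² ^ j) ⟩
      s * s * D² * (s ^ (j ℕ.* 2) * D² ^ j)      ≈⟨ *-cong (*-congʳ s²≈δ²) (even-power s²≈δ² j) ⟩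
      δ * δ * D² * 1#                           ≈⟨ modulo (δ * D + 1#) δ*D≈1
        (solve 2 (λ δ D → δ :* δ :* (D :* D) :* con (+ 1) :=
          con (+ 1) :+ (δ :* D :- con (+ 1)) :* (δ :* D :+ con (+ 1))) δ D) ⟩
      1#                                       ∎
      where open SetoidReasoning setoid

    /-≈ : ∀ {x y z} (y#0 : y # 0#) → y * z ≈ 1# → x / y [ y#0 ] ≈ x * z
    /-≈ {x} {y} {z} y#0 y*z≈1 = modulo₂ (x * z) (- (x * y#0 ⁻¹)) (⁻¹-inverse y#0) y*z≈1
      (solve 4 (λ x y z i → x :* i :=
        x :* z :+ ((y :* i :- con (+ 1)) :* (x :* z) :+ (y :* z :- con (+ 1)) :* :- (x :* i))) x y z (y#0 ⁻¹))

    over≈ : ∀ j {z} → over[2q-1]^ q q<½ (j ℕ.* 2) z ≈ z * D² ^ j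
    over≈ j = /-≈ (^-#0 (2x-1#0 q<½) (j ℕ.* 2)) (even-power
      (trans (*-cong 2q-1≈ 2q-1≈) (solve 1 (λ δ → :- δ :* :- δ := δ :* δ) δ)) j)
      where
      2q-1≈ : 2 · q - 1# ≈ - δ
      2q-1≈ = solve 1 (λ q → q :+ (q :+ con (+ 0)) :- con (+ 1) := :- (con (+ 1) :- con (+ 2) :* q)) q

    infixl 6 _⊕_ _⊖_
    _⊕_ : ∀ {a a′ b b′} → a ≈ a′ → b ≈ b′ → a + b ≈ a′ + b′
    _⊕_ = +-cong

    _⊖_ : ∀ {a a′ b b′} → a ≈ a′ → b ≈ b′ → a - b ≈ a′ - b′
    a≈a′ ⊖ b≈b′ = +-cong a≈a′ (-‿cong b≈b′)

    expansion≈ : ∀ k → expansion q q<½ (suc k) ≈ D² * D² * Eₖ k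
    expansion≈ k = trans
      (trans (over≈ 2) (*-congʳ (*-congˡ (·-con 4 (q ^ 2) ⊖ ·-con 3 q ⊖ ·-con 2 1#)))
      ⊖ *-congʳ (trans (over≈ 3) (*-congʳ (*-congˡ (·-con 4 (q ^ 2) ⊕ ·-con 2 q ⊖ ·-con 7 1#))))
      ⊖ *-congʳ (trans (over≈ 4) (*-congʳ (*-congˡ
          (·-con 24 (q ^ 4) ⊖ ·-con 12 (q ^ 3) ⊖ ·-con 58 (q ^ 2) ⊕ ·-con 29 q ⊕ ·-con 18 1#))))
      ⊖ *-congʳ (trans (over≈ 5) (*-congʳ (*-congˡ
          (·-con 144 (q ^ 6) ⊖ ·-con 216 (q ^ 5) ⊖ ·-con 348 (q ^ 4) ⊕ ·-con 444 (q ^ 3) ⊕ ·-con 328 (q ^ 2)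
            ⊖ ·-con 312 q ⊖ ·-con 41 1#))))
      ⊖ *-congʳ (trans (over≈ 6) (*-congʳ (*-congˡ
          (·-con 864 (q ^ 8) ⊖ ·-con 2160 (q ^ 7) ⊖ ·-con 1704 (q ^ 6) ⊕ ·-con 4956 (q ^ 5)
            ⊕ ·-con 4632 (q ^ 4)
            ⊖ ·-con 9972 (q ^ 3) ⊕ ·-con 1586 (q ^ 2) ⊕ ·-con 1711 q ⊕ ·-con 88 1#)))))
      (solve 7 (λ e₀ e₁ e₂ e₃ e₄ d x → let y = x :* d in
        e₀ :* d :^ 2 :- e₁ :* d :^ 3 :* x :- e₂ :* d :^ 4 :* x :^ 2 :- e₃ :* d :^ 5 :* x :^ 3
          :- e₄ :* d :^ 6 :* x :^ 4 :=
        d :* d :* (e₀ :- e₁ :* y :- e₂ :* y :^ 2 :- e₃ :* y :^ 3 :- e₄ :* y :^ 4))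
        (⟦ e₀ Q ⟧ (at k y,q)) (⟦ e₁ Q ⟧ (at k y,q)) (⟦ e₂ Q ⟧ (at k y,q)) (⟦ e₃ Q ⟧ (at k y,q))
          (⟦ e₄ Q ⟧ (at k y,q)) D² (x k))

    limitVariance≈ : ∀ k → limitVariance q q<½ ≈ D² * D² * ⟦ e₀ Q ⟧ (at k y,q)
    limitVariance≈ k = begin
      limitVariance q q<½  ≈⟨ /-≈ (^-#0 (1-2x#0 q<½) 4) (even-power (*-cong 1-2q≈δ 1-2q≈δ) 2) ⟩
      (1# - q) * (2 · 1# + 3 · q - 4 · q ^ 2) * D² ^ 2
        ≈⟨ *-congʳ (*-congˡ (·-con 2 1# ⊕ ·-con 3 q ⊖ ·-con 4 (q ^ 2))) ⟩
      _ ≈⟨ solve 2 (λ q d → (con (+ 1) :- q) :* (2 :· con (+ 1) :+ 3 :· q :- 4 :· q :^ 2) :* d :^ 2 :=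
        d :* d :* e₀ q) q D² ⟩
      D² * D² * ⟦ e₀ Q ⟧ (at k y,q) ∎
      where
      open SetoidReasoning setoid
      1-2q≈δ : 1# - 2 · q ≈ δ
      1-2q≈δ = solve 1 (λ q → con (+ 1) :- (q :+ (q :+ con (+ 0))) := con (+ 1) :- con (+ 2) :* q) q

    O-expansion : O 1 (λ k → expansion q q<½ (suc k) - limitVariance q q<½)
    O-expansion =
      O-resp {s = λ k → D² * D² * ⟦ E Q Y :- e₀ Q ⟧ (at k y,q)} {t =
        λ k → expansion q q<½ (suc k) - limitVariance q q<½}
      (λ k → trans
        (solve 3 (λ d a b → d :* d :* (a :- b) := d :* d :* a :- d :* d :* b) D² (Eₖ k) (⟦ e₀ Q ⟧ (at k y,q)))
        (+-cong (sym (expansion≈ k)) (-‿cong (sym (limitVariance≈ k)))))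
      (O-* (O-const (D² * D²)) (O-vanishing 1 (E Q Y :- e₀ Q) tt O-y (O-const q ∷ [])))

    module _ (V : ℕ → Carrier) (V-variance : ∀ n .{{_ : NonZero n}} → IsConditionalVariance q n (V n)) where

      private
        h : Carrier
        h = ½ * ½ * (q⁻¹ * q⁻¹)

      -- The residual is 4q²x²g² times the difference sought; `h` is 1/(4q²), and the two factors
      -- `ν k` undo x².
      residual≈ : ∀ k → ν k * (ν k * (h * (g⁻¹ k * g⁻¹ k) * Rₖ k)) ≈ V (suc k) - expansion q q<½ (suc k)
      residual≈ k = begin
        ν k * (ν k * (h * (g⁻¹ k * g⁻¹ k) * Rₖ k))
          ≈⟨ *-congˡ (*-congˡ (*-congˡ Rₖ≈)) ⟩
        ν k * (ν k * (h * (g⁻¹ k * g⁻¹ k)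
          * ((2# + 2#) * (q * q) * (x k * x k) * (g k * g k) * (v - D² * D² * Eₖ k))))
          ≈⟨ solve 8 (λ ν x q i g j h w →
            ν :* (ν :* (h :* h :* (i :* i) :* (j :* j)
              :* ((con (+ 2) :+ con (+ 2)) :* (q :* q) :* (x :* x) :* (g :* g) :* w))) :=
              (ν :* x) :^ 2 :* (q :* i) :^ 2 :* (g :* j) :^ 2 :* (h :+ h) :^ 2 :* w)
              (ν k) (x k) q q⁻¹ (g k) (g⁻¹ k) ½ (v - D² * D² * Eₖ k) ⟩
        (ν k * x k) ^ 2 * (q * q⁻¹) ^ 2 * (g k * g⁻¹ k) ^ 2 * (½ + ½) ^ 2 * (v - D² * D² * Eₖ k)
          ≈⟨ *-congʳ (*-cong (*-cong (*-cong (one (ν*x≈1 k)) (one q*q⁻¹≈1)) (one (g*g⁻¹≈1 k))) (one ½+½≈1)) ⟩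
        1# * 1# * 1# * 1# * (v - D² * D² * Eₖ k)
          ≈⟨ solve 1 (λ w → let 1′ = con (+ 1) in 1′ :* 1′ :* 1′ :* 1′ :* w := w) (v - D² * D² * Eₖ k) ⟩
        v - D² * D² * Eₖ k
          ≈⟨ +-congˡ (-‿cong (expansion≈ k)) ⟨
        v - expansion q q<½ (suc k) ∎
        where
        open SetoidReasoning setoid
        v = V (suc k)
        one : ∀ {z} → z ≈ 1# → z ^ 2 ≈ 1#
        one z≈1 = trans (^-congˡ 2 z≈1) (1^≈1 2)
        Rₖ≈ : Rₖ k ≈ (2# + 2#) * (q * q) * (x k * x k) * (g k * g k) * (v - D² * D² * Eₖ k)
        Rₖ≈ = trans (+-congʳ (sym (Variance.variance-equation k (V-variance (suc k)))))
          (solve 6 (λ q x g v D E → let d = D :* D ; y = x :* d ; 4q² = (con (+ 2) :+ con (+ 2)) :* (q :* q) in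
            4q² :* (x :* x) :* (g :* g) :* v :- 4q² :* (y :* y) :* (g :* g) :* E :=
            4q² :* (x :* x) :* (g :* g) :* (v :- d :* d :* E)) q (x k) (g k) v D (Eₖ k))

      O-V-expansion : O 5 (λ k → V (suc k) - expansion q q<½ (suc k))
      O-V-expansion =
        O-resp {s = λ k → ν k * (ν k * (h * (g⁻¹ k * g⁻¹ k) * Rₖ k))} {t =
          λ k → V (suc k) - expansion q q<½ (suc k)}
        -- Each `O-ν` lowers the order by one, from 7 to 5.
        residual≈ (O-ν (O-ν (O-* (O-* (O-const h) (O-* O-g⁻¹ O-g⁻¹)) O-residual)))

      V⟶limit : V ⟶ limitVariance q q<½
      -- The hypothesis says nothing about `V 0`, so the limit is taken along n = k + 1.
      V⟶limit = ⟶-suc (O⇒⟶ (O-resp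
        {s = λ k → (V (suc k) - expansion q q<½ (suc k)) + (expansion q q<½ (suc k) - limitVariance q q<½)}
        {t = λ k → V (suc k) - limitVariance q q<½}
        (λ k → solve 3 (λ v e l → v :- e :+ (e :- l) := v :- l) (V (suc k)) (expansion q q<½ (suc k))
          (limitVariance q q<½))
        (O-+ (O-weaken (O-weaken (O-weaken (O-weaken O-V-expansion)))) O-expansion)))

      V-expansion : ∃[ C ] ∃[ N ] ∀ n .{{_ : NonZero n}} → N ℕ.≤ n → ∣ V n - expansion q q<½ n ∣≤ C * 1/ n ^ 5
      V-expansion = O.constant O-V-expansion , 0 , λ { (suc k) _ → O.estimate O-V-expansion k }

    conditionalVariance-exists : ∀ n .{{_ : NonZero n}} → ∃[ v ] IsConditionalVariance q n v
    conditionalVariance-exists (suc k) = Variance.variance-exists k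

theorem6 : ∀ {c ℓ₁ ℓ₂} (ℝ : Reals c ℓ₁ ℓ₂) → let open TwoPhaseGame ℝ in
    ∀ (q : Carrier) → 0# < q → (q<½ : q < ½) →
    (∀ n .{{_ : NonZero n}} → ∃[ v ] IsConditionalVariance q n v)
    × (∀ (V : ℕ → Carrier) → (∀ n .{{_ : NonZero n}} → IsConditionalVariance q n (V n)) →
    V ⟶ limitVariance q q<½
    × ∃[ C ] ∃[ N ] ∀ n .{{_ : NonZero n}} → N ℕ.≤ n →
    ∣ V n - expansion q q<½ n ∣≤ C * 1/ n ^ 5)
theorem6 ℝ q 0<q q<½ =
  conditionalVariance-exists q 0<q q<½ ,
  λ V V-variance → V⟶limit q 0<q q<½ V V-variance , V-expansion q 0<q q<½ V V-variance
  where open ConditionalVariance ℝ
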